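{- Let $G$ be an abelian group, $\alpha,\beta\in G$, and let $\lambda,\pi$ be two non-empty set partitions. For a set $T$ of partitions write $s_{\alpha,\beta}(T)$ for the multiset $\{s_{\alpha,\beta}(t): t\in T\}$. (a) If $s_{\alpha,\beta}(\mathcal{T}(\lambda,l))=s_{\alpha,\beta}(\mathcal{T}(\pi,l))$ for $l=0,1$, then $s_{\alpha,\beta}(\mathcal{T}(\lambda,l,m))=s_{\alpha,\beta}(\mathcal{T}(\pi,l,m))$ for all $l,m\ge 0$. (b) If $s_{\alpha,\beta}(\mathcal{T}(\lambda,l))=s_{\beta,\alpha}(\mathcal{T}(\pi,l))$ for $l=0,1$, then $s_{\alpha,\beta}(\mathcal{T}(\lambda,l,m))=s_{\beta,\alpha}(\mathcal{T}(\pi,l,m))$ for all $l,m\ge 0$.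
   Context: A partition of $[n]=\{1,\dots,n\}$ is a collection of disjoint nonempty blocks with union $[n]$; $\Pi_n$ is the set of partitions of $[n]$ ($\Pi_0$ contains only the empty partition). A partition is represented as a graph on $[n]$ whose arcs join consecutive elements of each block: a block $\{a_1<\dots<a_j\}$ gives arcs $(a_1,a_2),\dots,(a_{j-1},a_j)$. Two arcs $(i_1,j_1),(i_2,j_2)$ form a crossing if $i_1<i_2<j_1<j_2$ and a nesting if $i_1<i_2<j_2<j_1$; $cr(\pi)$ and $ne(\pi)$ are the numbers of crossings and nestings of $\pi$. For $\alpha,\beta$ in an abelian group $G$, $s_{\alpha,\beta}(\pi)=cr(\pi)\alpha+ne(\pi)\beta$. The tree of partitions $\mathcal{T}(\Pi)$ is the rooted tree whose nodes are all partitions, with root the empty partition, where a partition $\mu$ of $[n+1]$ is a child of a partition $\lambda$ of $[n]$ iff the restriction of $\mu$ to $\{2,\dots,n+1\}$ is order-isomorphic to $\lambda$. $\mathcal{T}(\lambda)$ is the subtree rooted at $\lambda$; $\mathcal{T}(\lambda,l)$ is the set of partitions at level $l$ of $\mathcal{T}(\lambda)$ (equivalently, if $\lambda\in\Pi_n$, the partitions of $[n+l]$ whose restriction to the last $n$ elements is order-isomorphic to $\lambda$); $\mathcal{T}(\lambda,l,m)$ is the set of those with exactly $m$ blocks. -}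

module Defs where

import Level

open import Data.Nat using (ℕ; zero; suc; _+_; _≤ᵇ_; _<ᵇ_; _≡ᵇ_)
open import Data.Bool using (Bool; true; false; _∧_; if_then_else_; not)
open import Data.List using (List; []; _∷_; length; map; concatMap; upTo; filterᵇ)
open import Data.Nat.ListAction using (sum)
open import Data.Bool.ListAction using (and; any)
open import Algebra.Bundles using (AbelianGroup)
import Data.List.Relation.Binary.Permutation.Setoid as PermS

-- A partition of [n] is encoded by its restricted growth string: a list
-- w = (w₀,…,w_{n-1}) where w_i is the label of the block containing i+1,
-- blocks are labelled 0,1,2,… in order of their minimal elements.
-- (This is a bijective encoding of set partitions of [n].)

-- label at position i (0-based); default 0 outside the range (never used)
at : List ℕ → ℕ → ℕ
at []       _       = 0
at (x ∷ _)  zero    = x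
at (_ ∷ xs) (suc i) = at xs i

-- restricted-growth check, b = number of blocks opened so far
rgs : ℕ → List ℕ → Bool
rgs b []       = true
rgs b (x ∷ xs) = (x ≤ᵇ b) ∧ rgs (if x ≡ᵇ b then suc b else b) xs

isRGS : List ℕ → Bool
isRGS = rgs 0

words : ℕ → ℕ → List (List ℕ)
words k zero    = [] ∷ []
words k (suc m) = concatMap (λ x → map (x ∷_) (words k m)) (upTo k)

Π : ℕ → List (List ℕ)
Π n = filterᵇ isRGS (words n n)

idx : List ℕ → List ℕ
idx w = upTo (length w)

count : (ℕ → Bool) → List ℕ → ℕ
count p xs = sum (map (λ x → if p x then 1 else 0) xs)

isArc : List ℕ → ℕ → ℕ → Bool
isArc w i j = (i <ᵇ j) ∧ (j <ᵇ length w) ∧ (at w i ≡ᵇ at w j)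
  ∧ not (any (λ k → (i <ᵇ k) ∧ (k <ᵇ j) ∧ (at w k ≡ᵇ at w i)) (upTo (length w)))

countArcPairs : (ℕ → ℕ → ℕ → ℕ → Bool) → List ℕ → ℕ
countArcPairs ord w =
  Σᵢ (λ i₁ → Σᵢ (λ j₁ → Σᵢ (λ i₂ → count (λ j₂ →
      isArc w i₁ j₁ ∧ isArc w i₂ j₂ ∧ ord i₁ j₁ i₂ j₂) (idx w))))
  where
  Σᵢ : (ℕ → ℕ) → ℕ
  Σᵢ f = sum (map f (idx w))

cr : List ℕ → ℕ
cr = countArcPairs (λ i₁ j₁ i₂ j₂ → (i₁ <ᵇ i₂) ∧ (i₂ <ᵇ j₁) ∧ (j₁ <ᵇ j₂))

ne : List ℕ → ℕ
ne = countArcPairs (λ i₁ j₁ i₂ j₂ → (i₁ <ᵇ i₂) ∧ (i₂ <ᵇ j₂) ∧ (j₂ <ᵇ j₁))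

blocks : List ℕ → ℕ
blocks w = count (λ i → not (any (λ k → (k <ᵇ i) ∧ (at w k ≡ᵇ at w i)) (idx w))) (idx w)

_==ᴮ_ : Bool → Bool → Bool
true  ==ᴮ b = b
false ==ᴮ b = not b

-- μ (partition of [n+l]) restricted to its last n elements is
-- order-isomorphic to λ (partition of [n])
restrictsTo : List ℕ → ℕ → List ℕ → Bool
restrictsTo lam l μ = and (map (λ i → and (map (λ j →
    (at lam i ≡ᵇ at lam j) ==ᴮ (at μ (l + i) ≡ᵇ at μ (l + j))) (idx lam))) (idx lam))

𝒯 : List ℕ → ℕ → List (List ℕ)
𝒯 lam l = filterᵇ (restrictsTo lam l) (Π (length lam + l))

𝒯ᵐ : List ℕ → ℕ → ℕ → List (List ℕ)
𝒯ᵐ lam l m = filterᵇ (λ μ → blocks μ ≡ᵇ m) (𝒯 lam l)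

module _ {c ℓ} (G : AbelianGroup c ℓ) where
  open AbelianGroup G

  mult : ℕ → Carrier → Carrier
  mult zero    x = ε
  mult (suc n) x = x ∙ mult n x

  s : Carrier → Carrier → List ℕ → Carrier
  s α β w = mult (cr w) α ∙ mult (ne w) β

  sMulti : Carrier → Carrier → List (List ℕ) → List Carrier
  sMulti α β T = map (s α β) T

  _≡ₘ_ : List Carrier → List Carrier → Set (c Level.⊔ ℓ)
  _≡ₘ_ = PermS._↭_ setoid

{-# OPTIONS --safe #-}

-- Prepend to a partition w a new first element. If it joins the t-th block, the arc it
-- creates ends at the first element of that block, and s grows by an "entry" x_t = (number of
-- arcs over that element) α + (number of arcs ending before it) β; if it is a singleton, s does
-- not change. The entries of the child are again determined by those of w: joining block t
-- turns (x_0,…,x_{k-1}) into (0, x_0+α,…,x_{t-1}+α, x_{t+1}+β,…,x_{k-1}+β), and a singleton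
-- turns it into (0, x_0,…,x_{k-1}). Hence the multiset at level l is s(w) + F_l(x) for a
-- recursively defined F_l. By induction, F_l is symmetric in the entries and affine in each of
-- them, F_l(x, y…) = A(y…) + (x + B(y…)): an exchange of neighbours x, y replaces
-- x+F(y+β,…) ∪ y+F(x+α,…) by y+F(x+β,…) ∪ x+F(y+α,…), and both have the parts
-- x+A, y+A, x+y+α+B, x+y+β+B. So levels 0 and 1, which give s(w) and the multiset of entries,
-- determine all levels. Reversing the entries exchanges the roles of α and β, hence F_l is
-- also symmetric in α and β, which is part (b).

module Submission where

open import Defs
open import Level using (_⊔_)
open import Data.Nat using (ℕ; zero; suc; pred; _+_; _<_; _≤_; s≤s; z≤n; _<ᵇ_; _≤ᵇ_; _≡ᵇ_)
open import Data.Nat.Properties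
open import Data.Nat.ListAction using (sum)
open import Data.Bool using (Bool; true; false; _∧_; _∨_; not; if_then_else_; T)
open import Data.Bool.Properties using (T-≡; T-∧; ∧-zeroʳ; ∧-identityʳ; ∧-assoc; ∧-comm)
open import Data.Bool.ListAction using (and; any; or)
open import Data.List using (List; []; _∷_; [_]; _++_; _∷ʳ_; map; length; upTo; applyUpTo; concat; concatMap; filterᵇ; cartesianProductWith)
open import Data.List.Properties using (map-++; map-cong; map-injective; length-map; map-upTo; map-applyUpTo; length-applyUpTo; applyUpTo-∷ʳ; ++-identityʳ; concat-++; concatMap-++; concatMap-cong; concatMap-pure; filter-++; ∷-injective; ∷-injectiveʳ)
open import Data.List.Membership.Propositional using (_∈_; find; lose)
open import Data.List.Membership.Propositional.Properties using (∈-applyUpTo⁺; ∈-applyUpTo⁻; ∈-upTo⁺; ∈-filter⁺; ∈-filter⁻; ∈-concatMap⁺; ∈-concatMap⁻; ∈-cartesianProductWith⁺; ∈-cartesianProductWith⁻)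
open import Data.List.Membership.Propositional.Properties.WithK using (unique∧set⇒bag)
open import Data.List.Relation.Binary.BagAndSetEquality using (∼bag⇒↭)
open import Data.List.Relation.Binary.Permutation.Propositional as Perm using () renaming (_↭_ to _↭ₚ_; ↭-refl to ↭ₚ-refl; ↭-trans to ↭ₚ-trans; ↭-reflexive to ↭ₚ-reflexive)
import Data.List.Relation.Binary.Permutation.Propositional.Properties as Permₚ
import Data.List.Relation.Binary.Permutation.Setoid as SetoidPermutation
import Data.List.Relation.Binary.Permutation.Setoid.Properties as SetoidPermutationProperties
open import Data.List.Relation.Binary.Pointwise using (Pointwise; []; _∷_)
open import Data.List.Relation.Unary.All as All using (All; []; _∷_)
open import Data.List.Relation.Unary.AllPairs using ([]; _∷_)
open import Data.List.Relation.Unary.Any using (here)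
open import Data.List.Relation.Unary.Unique.Propositional using (Unique)
import Data.List.Relation.Unary.Unique.Propositional.Properties as Unique
open import Data.Product using (_×_; _,_; ∃; proj₁; proj₂)
open import Data.Sum using (inj₁; inj₂)
open import Data.Unit using (tt)
open import Function using (_∘_; Injective; Equivalence; mk⇔)
open import Algebra.Bundles using (AbelianGroup; CommutativeMonoid)
import Algebra.Properties.CommutativeSemigroup as CommutativeSemigroupProperties
open import Relation.Binary using (tri<; tri≈; tri>)
open import Relation.Binary.PropositionalEquality as ≡ using (_≡_; _≢_; refl; sym; trans; cong; cong₂; subst; module ≡-Reasoning)
open import Relation.Nullary using (¬_; yes; no; contradiction)
open import Relation.Nullary.Decidable using (T?)

open CommutativeSemigroupProperties +-commutativeSemigroup using () renaming (interchange to +-interchange)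

-- Multisets in an abelian group and the recursion for the levels.

module Recursion {c ℓ} (G : AbelianGroup c ℓ) where

  open AbelianGroup G renaming (refl to ≈-refl; sym to ≈-sym; trans to ≈-trans)
  open SetoidPermutation setoid public
    renaming (refl to ↭-pointwise; trans to ↭-compose)
  open SetoidPermutationProperties setoid public
    using (++⁺; ++⁺ˡ; ++⁺ʳ; ++-comm; shifts; xs↭ys⇒|xs|≡|ys|; drop-∷; ∷↭∷ʳ; ++-commutativeMonoid)
    renaming (map⁺ to ↭-map⁺; ++-assoc to ↭-assoc)
  open CommutativeSemigroupProperties
    (CommutativeMonoid.commutativeSemigroup ++-commutativeMonoid) public using (interchange)
  open PermutationReasoning

  infixr 6 _·_

  _·_ : Carrier → List Carrier → List Carrier
  g · xs = map (g ∙_) xs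

  ·-cong : ∀ {g h xs ys} → g ≈ h → xs ↭ ys → g · xs ↭ h · ys
  ·-cong {g} {h} {xs} {ys} g≈h p = ↭-trans (↭-pointwise (pointwise xs)) (↭-map⁺ setoid ∙-congˡ p)
    where
    pointwise : ∀ zs → Pointwise _≈_ (g · zs) (h · zs)
    pointwise []       = []
    pointwise (z ∷ zs) = ∙-congʳ g≈h ∷ pointwise zs

  ·-congˡ : ∀ {g xs ys} → xs ↭ ys → g · xs ↭ g · ys
  ·-congˡ = ·-cong ≈-refl

  ·-++ : ∀ g xs ys → g · (xs ++ ys) ↭ g · xs ++ g · ys
  ·-++ g xs ys = ↭-reflexive (map-++ (g ∙_) xs ys)

  ·-assoc : ∀ g h xs → g · h · xs ↭ (g ∙ h) · xs
  ·-assoc g h []       = ↭-refl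
  ·-assoc g h (x ∷ xs) = prep (≈-sym (assoc g h x)) (·-assoc g h xs)

  ·-comm : ∀ g h xs → g · h · xs ↭ h · g · xs
  ·-comm g h xs = ↭-trans (·-assoc g h xs)
    (↭-trans (·-cong (comm g h) ↭-refl) (↭-sym (·-assoc h g xs)))

  ·-identity : ∀ xs → ε · xs ↭ xs
  ·-identity []       = ↭-refl
  ·-identity (x ∷ xs) = prep (identityˡ x) (·-identity xs)

  -- Union of multisets plays the part of addition and translation by `x` that of the linear term.
  -- Affinity is only stated for the first entry, since `resp` brings any other entry to the front.
  record SymmetricAffine (f : List Carrier → List Carrier) : Set (c ⊔ ℓ) where
    field
      resp   : ∀ {xs ys} → xs ↭ ys → f xs ↭ f ys
      base   : List Carrier → List Carrier
      slope  : List Carrier → List Carrier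
      affine : ∀ x xs → f (x ∷ xs) ↭ base xs ++ x · slope xs

  open SymmetricAffine

  prepend : ∀ {f} → SymmetricAffine f → ∀ a → SymmetricAffine (f ∘ (a ∷_))
  prepend sf a .resp p      = resp sf (↭-prep a p)
  prepend sf a .base        = base sf ∘ (a ∷_)
  prepend sf a .slope       = slope sf ∘ (a ∷_)
  prepend sf a .affine x xs = ↭-trans (resp sf (↭-swap a x ↭-refl)) (affine sf x (a ∷ xs))

  infixl 5 _⊕_
  _⊕_ : ∀ {f g} → SymmetricAffine f → SymmetricAffine g → SymmetricAffine (λ xs → f xs ++ g xs)
  (sf ⊕ sg) .resp p   = ++⁺ (resp sf p) (resp sg p)
  (sf ⊕ sg) .base xs  = base sf xs ++ base sg xs
  (sf ⊕ sg) .slope xs = slope sf xs ++ slope sg xs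
  _⊕_ {f} {g} sf sg .affine x xs = begin
    f (x ∷ xs) ++ g (x ∷ xs)
      ↭⟨ ++⁺ (affine sf x xs) (affine sg x xs) ⟩
    (base sf xs ++ x · slope sf xs) ++ (base sg xs ++ x · slope sg xs)
      ↭⟨ interchange (base sf xs) _ _ _ ⟩
    (base sf xs ++ base sg xs) ++ (x · slope sf xs ++ x · slope sg xs)
      ↭⟨ ++⁺ˡ (base sf xs ++ base sg xs) (·-++ x (slope sf xs) (slope sg xs)) ⟨
    (base sf xs ++ base sg xs) ++ x · (slope sf xs ++ slope sg xs) ∎

  module Pick (α β : Carrier) where

    -- The new first element joins the block with entry x: its arc passes over the first
    -- elements of the earlier blocks (a future crossing, α) and ends before those of the
    -- later blocks (a future nesting, β).
    pick : (List Carrier → List Carrier) → List Carrier → List Carrier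
    pick f []       = []
    pick f (x ∷ xs) = x · f (β · xs) ++ pick (f ∘ (α ∙ x ∷_)) xs

    pick-cong : ∀ {f g} → (∀ ys → f ys ↭ g ys) → ∀ xs → pick f xs ↭ pick g xs
    pick-cong f↭g []       = ↭-refl
    pick-cong f↭g (x ∷ xs) = ++⁺ (·-congˡ (f↭g (β · xs))) (pick-cong (λ ys → f↭g (α ∙ x ∷ ys)) xs)

    -- Each exchange of neighbours x, y only affects the two terms that pick x or y;
    -- being affine, their sum is x·A + y·A + (x∙y)·(α·B + β·B).
    pick-swap : ∀ {f} → SymmetricAffine f → ∀ x y zs →
      x · f (β ∙ y ∷ zs) ++ y · f (α ∙ x ∷ zs) ↭ y · f (β ∙ x ∷ zs) ++ x · f (α ∙ y ∷ zs)
    pick-swap {f} sf x y zs = begin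
      x · f (β ∙ y ∷ zs) ++ y · f (α ∙ x ∷ zs)
        ↭⟨ ++⁺ (term x y β) (↭-trans (term y x α) (++⁺ˡ (y · A) (·-cong (comm y x) ↭-refl))) ⟩
      (x · A ++ (x ∙ y) · β · B) ++ (y · A ++ (x ∙ y) · α · B)
        ↭⟨ interchange (x · A) _ _ _ ⟩
      (x · A ++ y · A) ++ ((x ∙ y) · β · B ++ (x ∙ y) · α · B)
        ↭⟨ ++⁺ʳ _ (++-comm (x · A) (y · A)) ⟩
      (y · A ++ x · A) ++ ((x ∙ y) · β · B ++ (x ∙ y) · α · B)
        ↭⟨ interchange (y · A) _ _ _ ⟩
      (y · A ++ (x ∙ y) · β · B) ++ (x · A ++ (x ∙ y) · α · B)
        ↭⟨ ++⁺ (↭-trans (term y x β) (++⁺ˡ (y · A) (·-cong (comm y x) ↭-refl))) (term x y α) ⟨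
      y · f (β ∙ x ∷ zs) ++ x · f (α ∙ y ∷ zs) ∎
      where
      A = base sf zs
      B = slope sf zs
      term : ∀ u v γ → u · f (γ ∙ v ∷ zs) ↭ u · A ++ (u ∙ v) · γ · B
      term u v γ = begin
        u · f (γ ∙ v ∷ zs)           ↭⟨ ·-congˡ (affine sf (γ ∙ v) zs) ⟩
        u · (A ++ (γ ∙ v) · B)       ↭⟨ ·-++ u A _ ⟩
        u · A ++ u · (γ ∙ v) · B     ↭⟨ ++⁺ˡ (u · A) (·-congˡ (·-cong (comm γ v) ↭-refl)) ⟩
        u · A ++ u · (v ∙ γ) · B     ↭⟨ ++⁺ˡ (u · A) (·-congˡ (·-assoc v γ B)) ⟨
        u · A ++ u · v · γ · B       ↭⟨ ++⁺ˡ (u · A) (·-assoc u v _) ⟩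
        u · A ++ (u ∙ v) · γ · B     ∎

    -- Recursion on the derivation of the permutation, for all `f` at once: past the head, `f` is
    -- replaced by its `prepend`. Affinity enters only at `swap`, through `pick-swap`.
    pick-resp : ∀ {f} → SymmetricAffine f → ∀ {xs ys} → xs ↭ ys → pick f xs ↭ pick f ys
    pick-resp-prep : ∀ {f} → SymmetricAffine f → ∀ {x y xs ys} → x ≈ y → xs ↭ ys →
      pick (f ∘ (α ∙ x ∷_)) xs ↭ pick (f ∘ (α ∙ x ∷_)) ys → pick f (x ∷ xs) ↭ pick f (y ∷ ys)
    pick-resp-prep sf {ys = ys} x≈y p q = ++⁺ (·-cong x≈y (resp sf (·-congˡ p)))
      (↭-trans q (pick-cong (λ zs → resp sf (prep (∙-congˡ x≈y) ↭-refl)) ys))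

    -- The reflexive constructor carries a pointwise equality in the setoid, so it also has to be
    -- taken apart entry by entry.
    pick-resp sf (↭-pointwise [])           = ↭-refl
    pick-resp sf (↭-pointwise (x≈y ∷ p))    =
      pick-resp-prep sf x≈y (↭-pointwise p) (pick-resp (prepend sf _) (↭-pointwise p))
    pick-resp sf (prep x≈y p)        =
      pick-resp-prep sf x≈y p (pick-resp (prepend sf _) p)
    pick-resp {f} sf (swap {xs} {ys} {x} {y} {x′} {y′} x≈x′ y≈y′ p) = begin
      x · f (β ∙ y ∷ β · xs) ++ (y · f (α ∙ x ∷ β · xs) ++ pick (f ∘ (α ∙ x ∷_) ∘ (α ∙ y ∷_)) xs)
        ↭⟨ ↭-assoc (x · f (β ∙ y ∷ β · xs)) _ _ ⟨
      (x · f (β ∙ y ∷ β · xs) ++ y · f (α ∙ x ∷ β · xs)) ++ pick (f ∘ (α ∙ x ∷_) ∘ (α ∙ y ∷_)) xs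
        -- The later picks see `α ∙ x` and `α ∙ y` as the two leading entries, so for them the
        -- exchange is a swap inside `f`.
        ↭⟨ ++⁺ (pick-swap sf x y (β · xs))
             (pick-cong (λ zs → resp sf (swap (∙-congˡ x≈x′) (∙-congˡ y≈y′) ↭-refl)) xs) ⟩
      (y · f (β ∙ x ∷ β · xs) ++ x · f (α ∙ y ∷ β · xs)) ++ pick (f ∘ (α ∙ y′ ∷_) ∘ (α ∙ x′ ∷_)) xs
        ↭⟨ ++⁺ (++⁺ (·-cong y≈y′ (resp sf (prep (∙-congˡ x≈x′) (·-congˡ p))))
                    (·-cong x≈x′ (resp sf (prep (∙-congˡ y≈y′) (·-congˡ p)))))
             (pick-resp (prepend (prepend sf _) _) p) ⟩
      (y′ · f (β ∙ x′ ∷ β · ys) ++ x′ · f (α ∙ y′ ∷ β · ys)) ++ pick (f ∘ (α ∙ y′ ∷_) ∘ (α ∙ x′ ∷_)) ys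
        ↭⟨ ↭-assoc (y′ · f (β ∙ x′ ∷ β · ys)) _ _ ⟩
      y′ · f (β ∙ x′ ∷ β · ys) ++ (x′ · f (α ∙ y′ ∷ β · ys) ++ pick (f ∘ (α ∙ y′ ∷_) ∘ (α ∙ x′ ∷_)) ys) ∎
    pick-resp sf (↭-compose p q) = ↭-trans (pick-resp sf p) (pick-resp sf q)

    -- Here `x` is a constant already absorbed into `f`. Translations commute, so the splitting
    -- passes through each pick.
    pick-affine : ∀ x {f A B} → (∀ ys → f ys ↭ A ys ++ x · B ys) →
      ∀ xs → pick f xs ↭ pick A xs ++ x · pick B xs
    pick-affine x f↭ []       = ↭-refl
    pick-affine x {f} {A} {B} f↭ (z ∷ zs) = begin
      z · f (β · zs) ++ pick (f ∘ (α ∙ z ∷_)) zs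
        ↭⟨ ++⁺ (↭-trans (·-congˡ (f↭ (β · zs))) (·-++ z (A (β · zs)) _))
               (pick-affine x {A = A ∘ (α ∙ z ∷_)} {B ∘ (α ∙ z ∷_)} (λ ys → f↭ (α ∙ z ∷ ys)) zs) ⟩
      (z · A (β · zs) ++ z · x · B (β · zs)) ++ (pick (A ∘ (α ∙ z ∷_)) zs ++ x · pick (B ∘ (α ∙ z ∷_)) zs)
        ↭⟨ interchange (z · A (β · zs)) _ _ _ ⟩
      pick A (z ∷ zs) ++ (z · x · B (β · zs) ++ x · pick (B ∘ (α ∙ z ∷_)) zs)
        ↭⟨ ++⁺ˡ (pick A (z ∷ zs)) (++⁺ʳ _ (·-comm z x (B (β · zs)))) ⟩
      pick A (z ∷ zs) ++ (x · z · B (β · zs) ++ x · pick (B ∘ (α ∙ z ∷_)) zs)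
        ↭⟨ ++⁺ˡ (pick A (z ∷ zs)) (·-++ x (z · B (β · zs)) _) ⟨
      pick A (z ∷ zs) ++ x · pick B (z ∷ zs) ∎

    pick-symmetricAffine : ∀ {f} → SymmetricAffine f → SymmetricAffine (pick f)
    pick-symmetricAffine sf .resp      = pick-resp sf
    pick-symmetricAffine sf .base      = pick (base sf)
    -- Two sources contribute a translation by `x`: picking `x` itself, and picking a later entry,
    -- which leaves `α ∙ x` as an argument of `f` and so shifts the slope of `f` by `α`.
    pick-symmetricAffine {f} sf .slope xs = f (β · xs) ++ pick (λ ys → α · slope sf ys) xs
    pick-symmetricAffine {f} sf .affine x xs = begin
      x · f (β · xs) ++ pick (f ∘ (α ∙ x ∷_)) xs
        ↭⟨ ++⁺ˡ (x · f (β · xs)) (pick-affine x split xs) ⟩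
      x · f (β · xs) ++ (pick (base sf) xs ++ x · pick (λ ys → α · slope sf ys) xs)
        ↭⟨ shifts (x · f (β · xs)) (pick (base sf) xs) ⟩
      pick (base sf) xs ++ (x · f (β · xs) ++ x · pick (λ ys → α · slope sf ys) xs)
        ↭⟨ ++⁺ˡ (pick (base sf) xs) (·-++ x (f (β · xs)) _) ⟨
      pick (base sf) xs ++ x · (f (β · xs) ++ pick (λ ys → α · slope sf ys) xs) ∎
      where
      split : ∀ ys → f (α ∙ x ∷ ys) ↭ base sf ys ++ x · α · slope sf ys
      split ys = ↭-trans (affine sf (α ∙ x) ys) (++⁺ˡ (base sf ys)
        (↭-trans (·-cong (comm α x) ↭-refl) (↭-sym (·-assoc x α _))))

    -- All other entries precede the last one: they gain `α` when it is picked, and it gains `β`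
    -- when one of them is. So a last entry behaves like a first entry with `α` and `β` exchanged,
    -- which `pick-flip` exploits.
    pick-∷ʳ : ∀ {f} → SymmetricAffine f → ∀ x xs →
      pick f (xs ++ [ x ]) ↭ x · f (α · xs) ++ pick (f ∘ (β ∙ x ∷_)) xs
    pick-∷ʳ {f} sf x []       = ↭-refl
    pick-∷ʳ {f} sf x (z ∷ zs) = begin
      z · f (β · (zs ++ [ x ])) ++ pick (f ∘ (α ∙ z ∷_)) (zs ++ [ x ])
        ↭⟨ ++⁺ (·-congˡ (resp sf (↭-trans (·-++ β zs [ x ]) (++-comm (β · zs) [ β ∙ x ]))))
               (pick-∷ʳ (prepend sf _) x zs) ⟩
      z · f (β ∙ x ∷ β · zs) ++ (x · f (α ∙ z ∷ α · zs) ++ pick (λ ys → f (α ∙ z ∷ β ∙ x ∷ ys)) zs)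
        ↭⟨ shifts (z · f (β ∙ x ∷ β · zs)) (x · f (α ∙ z ∷ α · zs)) ⟩
      x · f (α ∙ z ∷ α · zs) ++ (z · f (β ∙ x ∷ β · zs) ++ pick (λ ys → f (α ∙ z ∷ β ∙ x ∷ ys)) zs)
        ↭⟨ ++⁺ˡ (x · f (α ∙ z ∷ α · zs)) (++⁺ˡ (z · f (β ∙ x ∷ β · zs))
             (pick-cong (λ ys → resp sf (↭-swap _ _ ↭-refl)) zs)) ⟩
      x · f (α ∙ z ∷ α · zs) ++ (z · f (β ∙ x ∷ β · zs) ++ pick (λ ys → f (β ∙ x ∷ α ∙ z ∷ ys)) zs) ∎

    -- The list that `pick` hands to `f` when it picks entry `i`, read by position. The children of
    -- a partition are enumerated by index, so this form can be compared with their entries.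
    without : (ℕ → Carrier) → ℕ → ℕ → Carrier
    without X zero    t       = β ∙ X (suc t)
    without X (suc i) zero    = α ∙ X 0
    without X (suc i) (suc t) = without (X ∘ suc) i t

    pick-applyUpTo : ∀ f X k →
      pick f (applyUpTo X k) ≡ concat (applyUpTo (λ i → X i · f (applyUpTo (without X i) (pred k))) k)
    pick-applyUpTo f X zero    = refl
    pick-applyUpTo f X (suc k) = cong₂ _++_
      (cong (λ ys → X 0 · f ys) (map-applyUpTo (X ∘ suc) (β ∙_) k))
      (trans (pick-applyUpTo (f ∘ (α ∙ X 0 ∷_)) (X ∘ suc) k) (cong concat (terms k)))
      where
      -- Splitting on `k` lets `pred k` compute; then the two sides agree by definition.
      terms : ∀ k →
        applyUpTo (λ i → X (suc i) · f (α ∙ X 0 ∷ applyUpTo (without (X ∘ suc) i) (pred k))) k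
          ≡ applyUpTo (λ i → X (suc i) · f (applyUpTo (without X (suc i)) k)) k
      terms zero    = refl
      terms (suc k) = refl

    -- The first summand is the singleton, the second the joins. In both, the block of the new first
    -- element has entry `ε`, because no arc passes over or ends before that element.
    step : (List Carrier → List Carrier) → List Carrier → List Carrier
    step f xs = f (ε ∷ xs) ++ pick (f ∘ (ε ∷_)) xs

    -- The level-l multiset of a tree node with entries xs, relative to the node's own value,
    -- restricted to descendants with m blocks.
    level : ℕ → ℕ → List Carrier → List Carrier
    level zero    m xs = if length xs ≡ᵇ m then [ ε ] else []
    level (suc l) m    = step (level l m)

    level-symmetricAffine : ∀ l m → SymmetricAffine (level l m)
    level-symmetricAffine zero m .resp p      =
      ↭-reflexive (cong (λ n → if n ≡ᵇ m then [ ε ] else []) (xs↭ys⇒|xs|≡|ys| p))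
    -- At level 0 only the number of entries matters, so `ε` merely fills the place of `x` and the
    -- slope is empty.
    level-symmetricAffine zero m .base xs     = level zero m (ε ∷ xs)
    level-symmetricAffine zero m .slope xs    = []
    level-symmetricAffine zero m .affine x xs = ↭-reflexive (sym (++-identityʳ _))
    level-symmetricAffine (suc l) m = prepend sf ε ⊕ pick-symmetricAffine (prepend sf ε)
      where sf = level-symmetricAffine l m

  open Pick

  -- After the parameters are exchanged in the tail by induction, the two summands are those of the
  -- exchanged `pick` with `x` moved to the end; symmetry brings `x` back to the front.
  pick-flip : ∀ α β {f} → SymmetricAffine f → ∀ xs → pick α β f xs ↭ pick β α f xs
  pick-flip α β sf []           = ↭-refl
  pick-flip α β {f} sf (x ∷ xs) = begin
    x · f (β · xs) ++ pick α β (f ∘ (α ∙ x ∷_)) xs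
      ↭⟨ ++⁺ˡ (x · f (β · xs)) (pick-flip α β (prepend sf _) xs) ⟩
    x · f (β · xs) ++ pick β α (f ∘ (α ∙ x ∷_)) xs
      ↭⟨ pick-∷ʳ β α sf x xs ⟨
    pick β α f (xs ++ [ x ])
      ↭⟨ pick-resp β α sf (∷↭∷ʳ x xs) ⟨
    pick β α f (x ∷ xs) ∎

  level-flip : ∀ α β l m xs → level α β l m xs ↭ level β α l m xs
  level-flip α β zero    m xs = ↭-refl
  level-flip α β (suc l) m xs = ++⁺ (level-flip α β l m (ε ∷ xs))
    (↭-trans (pick-cong α β (λ ys → level-flip α β l m (ε ∷ ys)) xs)
      (pick-flip α β (prepend (level-symmetricAffine β α l m) ε) xs))

-- Crossings and nestings by recursion on the word

𝟙 : Bool → ℕ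
𝟙 b = if b then 1 else 0

∑ : ℕ → (ℕ → ℕ) → ℕ
∑ n f = sum (map f (upTo n))

map-upTo-suc : ∀ {a} {A : Set a} (f : ℕ → A) n → map f (upTo (suc n)) ≡ f 0 ∷ map (f ∘ suc) (upTo n)
map-upTo-suc f n = cong (f 0 ∷_) (trans (map-applyUpTo suc f n) (sym (map-upTo (f ∘ suc) n)))

∑-suc : ∀ n f → ∑ (suc n) f ≡ f 0 + ∑ n (f ∘ suc)
∑-suc n f = cong sum (map-upTo-suc f n)

∑-cong : ∀ n {f g} → (∀ i → f i ≡ g i) → ∑ n f ≡ ∑ n g
∑-cong n f≗g = cong sum (map-cong f≗g (upTo n))

∑-zero : ∀ n {f} → (∀ i → f i ≡ 0) → ∑ n f ≡ 0
∑-zero zero    f≗0 = refl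
∑-zero (suc n) {f} f≗0 = trans (∑-suc n f) (cong₂ _+_ (f≗0 0) (∑-zero n (f≗0 ∘ suc)))

∑-+ : ∀ n f g → ∑ n (λ i → f i + g i) ≡ ∑ n f + ∑ n g
∑-+ zero    f g = refl
∑-+ (suc n) f g = begin
  ∑ (suc n) (λ i → f i + g i)                     ≡⟨ ∑-suc n _ ⟩
  f 0 + g 0 + ∑ n (λ i → f (suc i) + g (suc i))   ≡⟨ cong (f 0 + g 0 +_) (∑-+ n (f ∘ suc) (g ∘ suc)) ⟩
  f 0 + g 0 + (∑ n (f ∘ suc) + ∑ n (g ∘ suc))     ≡⟨ +-interchange (f 0) (g 0) _ _ ⟩
  f 0 + ∑ n (f ∘ suc) + (g 0 + ∑ n (g ∘ suc))     ≡⟨ cong₂ _+_ (∑-suc n f) (∑-suc n g) ⟨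
  ∑ (suc n) f + ∑ (suc n) g                       ∎
  where open ≡-Reasoning

∑-comm : ∀ m n (f : ℕ → ℕ → ℕ) → ∑ m (λ i → ∑ n (λ j → f i j)) ≡ ∑ n (λ j → ∑ m (λ i → f i j))
∑-comm zero    n f = sym (∑-zero n (λ _ → refl))
∑-comm (suc m) n f = begin
  ∑ (suc m) (λ i → ∑ n (f i))                        ≡⟨ ∑-suc m _ ⟩
  ∑ n (f 0) + ∑ m (λ i → ∑ n (f (suc i)))            ≡⟨ cong (∑ n (f 0) +_) (∑-comm m n (f ∘ suc)) ⟩
  ∑ n (f 0) + ∑ n (λ j → ∑ m (λ i → f (suc i) j))    ≡⟨ ∑-+ n (f 0) _ ⟨
  ∑ n (λ j → f 0 j + ∑ m (λ i → f (suc i) j))        ≡⟨ ∑-cong n (λ j → ∑-suc m (λ i → f i j)) ⟨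
  ∑ n (λ j → ∑ (suc m) (λ i → f i j))                ∎
  where open ≡-Reasoning

any-upTo-suc : ∀ p n → any p (upTo (suc n)) ≡ p 0 ∨ any (p ∘ suc) (upTo n)
any-upTo-suc p n = cong or (map-upTo-suc p n)

any-false : ∀ (xs : List ℕ) → any (λ _ → false) xs ≡ false
any-false []       = refl
any-false (x ∷ xs) = any-false xs

≡ᵇ-comm : ∀ m n → (m ≡ᵇ n) ≡ (n ≡ᵇ m)
≡ᵇ-comm zero    zero    = refl
≡ᵇ-comm zero    (suc n) = refl
≡ᵇ-comm (suc m) zero    = refl
≡ᵇ-comm (suc m) (suc n) = ≡ᵇ-comm m n

seen : ℕ → List ℕ → ℕ → Bool
seen x v j = any (λ k → (k <ᵇ j) ∧ (at v k ≡ᵇ x)) (upTo (length v))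

first : ℕ → List ℕ → ℕ → Bool
first x v j = (j <ᵇ length v) ∧ (x ≡ᵇ at v j) ∧ not (seen x v j)

-- An arc from the first position has no equal label in between, so it ends at the first occurrence
-- of `x` in the rest.
isArc-0-suc : ∀ x v j → isArc (x ∷ v) 0 (suc j) ≡ first x v j
isArc-0-suc x v j = cong (λ b → (j <ᵇ length v) ∧ (x ≡ᵇ at v j) ∧ not b)
  (any-upTo-suc (λ k → (0 <ᵇ k) ∧ (k <ᵇ suc j) ∧ (at (x ∷ v) k ≡ᵇ x)) (length v))

isArc-suc-suc : ∀ x v i j → isArc (x ∷ v) (suc i) (suc j) ≡ isArc v i j
isArc-suc-suc x v i j = cong (λ b → (i <ᵇ j) ∧ (j <ᵇ length v) ∧ (at v i ≡ᵇ at v j) ∧ not b)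
  (any-upTo-suc (λ k → (suc i <ᵇ k) ∧ (k <ᵇ suc j) ∧ (at (x ∷ v) k ≡ᵇ at v i)) (length v))

seen-0 : ∀ x v → seen x v 0 ≡ false
seen-0 x v = any-false (upTo (length v))

seen-suc : ∀ x y v j → seen x (y ∷ v) (suc j) ≡ (y ≡ᵇ x) ∨ seen x v j
seen-suc x y v j = any-upTo-suc (λ k → (k <ᵇ suc j) ∧ (at (y ∷ v) k ≡ᵇ x)) (length v)

first-0 : ∀ x y v → first x (y ∷ v) 0 ≡ (y ≡ᵇ x)
first-0 x y v rewrite seen-0 x (y ∷ v) | ≡ᵇ-comm x y with y ≡ᵇ x
... | true  = refl
... | false = refl

first-suc : ∀ x y v j → first x (y ∷ v) (suc j) ≡ not (y ≡ᵇ x) ∧ first x v j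
first-suc x y v j rewrite seen-suc x y v j with y ≡ᵇ x
... | true  = trans (cong ((j <ᵇ length v) ∧_) (∧-zeroʳ (x ≡ᵇ at v j))) (∧-zeroʳ (j <ᵇ length v))
... | false = refl

arcSum : List ℕ → (Bool → ℕ → ℕ → ℕ) → ℕ
arcSum w g = ∑ (length w) λ i → ∑ (length w) λ j → g (isArc w i j) i j

arcSum-cong : ∀ w {g h} → (∀ b i j → g b i j ≡ h b i j) → arcSum w g ≡ arcSum w h
arcSum-cong w g≗h = ∑-cong (length w) λ i → ∑-cong (length w) λ j → g≗h _ i j

arcSum-zero : ∀ w {g} → (∀ b i j → g b i j ≡ 0) → arcSum w g ≡ 0
arcSum-zero w g≗0 = ∑-zero (length w) λ i → ∑-zero (length w) λ j → g≗0 _ i j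

-- No arc ends at position 0, so that column vanishes. What remains is row 0, the arc created by
-- `x`, and the arcs of `v` shifted by one position.
arcSum-∷ : ∀ x v g → (∀ i j → g false i j ≡ 0) →
  arcSum (x ∷ v) g ≡ ∑ (length v) (λ j → g (first x v j) 0 (suc j)) + arcSum v (λ b i j → g b (suc i) (suc j))
arcSum-∷ x v g g0 = trans (∑-suc n _) (cong₂ _+_
  (trans (column 0) (∑-cong n λ j → cong (λ b → g b 0 (suc j)) (isArc-0-suc x v j)))
  (∑-cong n λ i → trans (column (suc i))
    (∑-cong n λ j → cong (λ b → g b (suc i) (suc j)) (isArc-suc-suc x v i j))))
  where
  n = length v
  column : ∀ i → ∑ (suc n) (λ j → g (isArc (x ∷ v) i j) i j) ≡ ∑ n (λ j → g (isArc (x ∷ v) i (suc j)) i (suc j))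
  column i = trans (∑-suc n _) (cong (_+ ∑ n (λ j → g (isArc (x ∷ v) i (suc j)) i (suc j))) (g0 i 0))

occ : List ℕ → ℕ → ℕ
occ []      y = 0
occ (z ∷ v) y = if z ≡ᵇ y then 1 else occ v y

-- 1 if both x and y occur in the word and x occurs first, else 0.
before : List ℕ → ℕ → ℕ → ℕ
before []      x y = 0
before (z ∷ v) x y =
  if z ≡ᵇ x then (if z ≡ᵇ y then 0 else occ v y) else (if z ≡ᵇ y then 0 else before v x y)

-- The numbers of arcs passing over, resp. ending before, the first occurrence of x.
over : List ℕ → ℕ → ℕ
over []      x = 0
over (y ∷ v) x = if y ≡ᵇ x then 0 else before v x y + over v x

left : List ℕ → ℕ → ℕ
left []      x = 0
left (y ∷ v) x = if y ≡ᵇ x then 0 else before v y x + left v x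

-- At most one position is a first occurrence, so the sum is an indicator.
∑-first : ∀ v y → ∑ (length v) (λ j → 𝟙 (first y v j)) ≡ occ v y
∑-first []      y = refl
∑-first (z ∷ v) y = trans (∑-suc (length v) _) (trans
  (cong₂ _+_ (cong 𝟙 (first-0 y z v)) (∑-cong (length v) λ j → cong 𝟙 (first-suc y z v j))) (split (z ≡ᵇ y)))
  where
  split : ∀ b → 𝟙 b + ∑ (length v) (λ j → 𝟙 (not b ∧ first y v j)) ≡ (if b then 1 else occ v y)
  split true  = cong suc (∑-zero (length v) λ _ → refl)
  split false = ∑-first v y

∑-before : ∀ v x y →
  ∑ (length v) (λ i → ∑ (length v) λ j → 𝟙 (first x v i ∧ first y v j ∧ (i <ᵇ j))) ≡ before v x y
∑-before []      x y = refl
∑-before (z ∷ v) x y = begin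
  ∑ (suc n) (λ i → ∑ (suc n) λ j → h (first x (z ∷ v) i) (first y (z ∷ v) j) i j)
    ≡⟨ trans (∑-suc n _) (cong₂ _+_ (row 0) (∑-cong n (row ∘ suc))) ⟩
  ∑ n (λ j → h (first x (z ∷ v) 0) (first y (z ∷ v) (suc j)) 0 (suc j))
    + ∑ n (λ i → ∑ n λ j → h (first x (z ∷ v) (suc i)) (first y (z ∷ v) (suc j)) i j)
    ≡⟨ cong₂ _+_
         (∑-cong n λ j → cong₂ (λ a b → h a b 0 (suc j)) (first-0 x z v) (first-suc y z v j))
         (∑-cong n λ i → ∑-cong n λ j → cong₂ (λ a b → h a b i j) (first-suc x z v i) (first-suc y z v j)) ⟩
  ∑ n (λ j → h (z ≡ᵇ x) (not (z ≡ᵇ y) ∧ first y v j) 0 (suc j))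
    + ∑ n (λ i → ∑ n λ j → h (not (z ≡ᵇ x) ∧ first x v i) (not (z ≡ᵇ y) ∧ first y v j) i j)
    ≡⟨ split (z ≡ᵇ x) (z ≡ᵇ y) ⟩
  before (z ∷ v) x y ∎
  where
  open ≡-Reasoning
  n = length v
  h : Bool → Bool → ℕ → ℕ → ℕ
  h a b i j = 𝟙 (a ∧ b ∧ (i <ᵇ j))
  h-zeroʳ : ∀ a b i j → b ∧ (i <ᵇ j) ≡ false → h a b i j ≡ 0
  h-zeroʳ a b i j eq = cong 𝟙 (trans (cong (a ∧_) eq) (∧-zeroʳ a))
  row : ∀ i → ∑ (suc n) (λ j → h (first x (z ∷ v) i) (first y (z ∷ v) j) i j)
    ≡ ∑ n (λ j → h (first x (z ∷ v) i) (first y (z ∷ v) (suc j)) i (suc j))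
  row i = trans (∑-suc n _) (cong (_+ ∑ n (λ j → h (first x (z ∷ v) i) (first y (z ∷ v) (suc j)) i (suc j)))
    (h-zeroʳ (first x (z ∷ v) i) (first y (z ∷ v) 0) i 0 (∧-zeroʳ (first y (z ∷ v) 0))))
  split : ∀ a b → ∑ n (λ j → h a (not b ∧ first y v j) 0 (suc j))
      + ∑ n (λ i → ∑ n λ j → h (not a ∧ first x v i) (not b ∧ first y v j) i j)
    ≡ (if a then (if b then 0 else occ v y) else (if b then 0 else before v x y))
  split true  true  = cong₂ _+_ (∑-zero n λ _ → refl) (∑-zero n λ _ → ∑-zero n λ _ → refl)
  split true  false = trans (cong₂ _+_
    (trans (∑-cong n λ j → cong 𝟙 (∧-identityʳ (first y v j))) (∑-first v y))
    (∑-zero n λ _ → ∑-zero n λ _ → refl)) (+-identityʳ (occ v y))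
  split false true  = cong₂ _+_ (∑-zero n λ _ → refl)
    (∑-zero n λ i → ∑-zero n λ j → h-zeroʳ (first x v i) false i j refl)
  split false false = cong₂ _+_ {u = ∑ n (λ i → ∑ n λ j → h (first x v i) (first y v j) i j)}
    (∑-zero n λ _ → refl) (∑-before v x y)

∧-false : ∀ a b {c} → c ≡ false → 𝟙 (a ∧ b ∧ c) ≡ 0
∧-false a b refl = cong 𝟙 (trans (cong (a ∧_) (∧-zeroʳ b)) (∧-zeroʳ a))

-- ord is the relative position of the two arcs, crossing or nesting.
module ArcPairs (ord : ℕ → ℕ → ℕ → ℕ → Bool)
  (ord-0   : ∀ i j k → ord i j 0 k ≡ false)
  (ord-1   : ∀ i k → ord 0 1 (suc i) k ≡ false)
  (ord-suc : ∀ i j k l → ord (suc i) (suc j) (suc k) (suc l) ≡ ord i j k l)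
  (ord-0-suc : ∀ j k l → ord 0 (suc (suc j)) (suc (suc k)) (suc (suc l)) ≡ ord 0 (suc j) (suc k) (suc l)) where

  -- The pairs whose first arc is the one created by prepending `x` to `v`.
  attached : List ℕ → ℕ → ℕ
  attached v x = ∑ (length v) λ j → arcSum v λ b k l → 𝟙 (first x v j ∧ b ∧ ord 0 (suc j) (suc k) (suc l))

  -- The pairs formed by the two arcs that start at `x` and `y` in `x ∷ y ∷ v`. Positions of `v` are
  -- therefore offset by two.
  initial : List ℕ → ℕ → ℕ → ℕ
  initial v x y = ∑ (length v) λ i → ∑ (length v) λ j →
    𝟙 (first x v i ∧ first y v j ∧ ord 0 (suc (suc i)) 1 (suc (suc j)))

  countArcPairs-∷ : ∀ x v → countArcPairs ord (x ∷ v) ≡ attached v x + countArcPairs ord v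
  countArcPairs-∷ x v = trans
    (arcSum-∷ x v (λ a i j → arcSum (x ∷ v) λ b k l → 𝟙 (a ∧ b ∧ ord i j k l)) (λ i j → arcSum-zero (x ∷ v) λ _ _ _ → refl))
    (cong₂ _+_
      (∑-cong (length v) λ j → inner (first x v j) 0 (suc j))
      (arcSum-cong v λ a i j → trans (inner a (suc i) (suc j))
        (arcSum-cong v λ b k l → cong (λ c → 𝟙 (a ∧ b ∧ c)) (ord-suc i j k l))))
    where
    -- The second arc of a pair starts after the first one, hence never at position 0.
    inner : ∀ a i j → arcSum (x ∷ v) (λ b k l → 𝟙 (a ∧ b ∧ ord i j k l))
      ≡ arcSum v (λ b k l → 𝟙 (a ∧ b ∧ ord i j (suc k) (suc l)))
    inner a i j = trans
      (arcSum-∷ x v (λ b k l → 𝟙 (a ∧ b ∧ ord i j k l)) (λ k l → cong 𝟙 (∧-zeroʳ a)))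
      (cong (_+ arcSum v (λ b k l → 𝟙 (a ∧ b ∧ ord i j (suc k) (suc l))))
        (∑-zero (length v) λ l → ∧-false a _ (ord-0 i j (suc l))))

  attached-∷ : ∀ x y v → attached (y ∷ v) x ≡ (if y ≡ᵇ x then 0 else initial v x y + attached v x)
  attached-∷ x y v = begin
    attached (y ∷ v) x
      -- The term `j = 0` is the arc from 0 to 1, inside which no other arc can start.
      ≡⟨ trans (∑-suc n _) (cong₂ _+_ (arcSum-zero (y ∷ v) λ b k l →
           ∧-false (first x (y ∷ v) 0) b (ord-1 k (suc l))) refl) ⟩
    ∑ n (λ j → arcSum (y ∷ v) λ b k l → 𝟙 (first x (y ∷ v) (suc j) ∧ b ∧ ord 0 (suc (suc j)) (suc k) (suc l)))
      ≡⟨ ∑-cong n (λ j → cong (λ a → arcSum (y ∷ v) λ b k l → 𝟙 (a ∧ b ∧ ord 0 (suc (suc j)) (suc k) (suc l)))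
           (first-suc x y v j)) ⟩
    ∑ n (λ j → arcSum (y ∷ v) λ b k l →
      𝟙 ((not (y ≡ᵇ x) ∧ first x v j) ∧ b ∧ ord 0 (suc (suc j)) (suc k) (suc l)))
      ≡⟨ split (y ≡ᵇ x) ⟩
    (if y ≡ᵇ x then 0 else initial v x y + attached v x) ∎
    where
    open ≡-Reasoning
    n = length v
    split : ∀ c → ∑ n (λ j → arcSum (y ∷ v) λ b k l →
        𝟙 ((not c ∧ first x v j) ∧ b ∧ ord 0 (suc (suc j)) (suc k) (suc l)))
      ≡ (if c then 0 else initial v x y + attached v x)
    split true  = ∑-zero n λ j → arcSum-zero (y ∷ v) λ _ _ _ → refl
    split false = trans (∑-cong n λ j → trans
        (arcSum-∷ y v (λ b k l → 𝟙 (first x v j ∧ b ∧ ord 0 (suc (suc j)) (suc k) (suc l)))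
          (λ k l → cong 𝟙 (∧-zeroʳ (first x v j))))
        (cong (∑ n (λ i → 𝟙 (first x v j ∧ first y v i ∧ ord 0 (suc (suc j)) 1 (suc (suc i)))) +_)
          (arcSum-cong v λ b k l → cong (λ c → 𝟙 (first x v j ∧ b ∧ c)) (ord-0-suc j k l))))
      (∑-+ n _ _)

module Crossing = ArcPairs (λ i₁ j₁ i₂ j₂ → (i₁ <ᵇ i₂) ∧ (i₂ <ᵇ j₁) ∧ (j₁ <ᵇ j₂))
  (λ _ _ _ → refl) (λ _ _ → refl) (λ _ _ _ _ → refl) (λ _ _ _ → refl)

nesting-1 : ∀ i k → (suc i <ᵇ k) ∧ (k <ᵇ 1) ≡ false
nesting-1 i zero    = refl
nesting-1 i (suc k) = ∧-zeroʳ (i <ᵇ k)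

module Nesting = ArcPairs (λ i₁ j₁ i₂ j₂ → (i₁ <ᵇ i₂) ∧ (i₂ <ᵇ j₂) ∧ (j₂ <ᵇ j₁))
  (λ _ _ _ → refl) nesting-1 (λ _ _ _ _ → refl) (λ _ _ _ → refl)

-- The arc from a prepended `x` starts to the left of everything, so the arcs crossing it are those
-- that pass over its endpoint, the first occurrence of `x`. For nestings they are those that end
-- before it.
attached≡over : ∀ v x → Crossing.attached v x ≡ over v x
attached≡over []      x = refl
attached≡over (y ∷ v) x = trans (Crossing.attached-∷ x y v)
  (cong₂ (λ p q → if y ≡ᵇ x then 0 else p + q) (∑-before v x y) (attached≡over v x))

attached≡left : ∀ v x → Nesting.attached v x ≡ left v x
attached≡left []      x = refl
attached≡left (y ∷ v) x = trans (Nesting.attached-∷ x y v)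
  (cong₂ (λ p q → if y ≡ᵇ x then 0 else p + q) initial≡before (attached≡left v x))
  where
  n = length v
  ∧-swap : ∀ a b c → a ∧ b ∧ c ≡ b ∧ a ∧ c
  ∧-swap a b c = trans (sym (∧-assoc a b c)) (trans (cong (_∧ c) (∧-comm a b)) (∧-assoc b a c))
  -- For nestings the condition on the endpoints is `j <ᵇ i`: the arc from `y` must end first. Hence
  -- the exchange of the two sums.
  initial≡before : Nesting.initial v x y ≡ before v y x
  initial≡before = trans (∑-comm n n λ i j → 𝟙 (first x v i ∧ first y v j ∧ (j <ᵇ i))) (trans
    (∑-cong n λ j → ∑-cong n λ i → cong 𝟙 (∧-swap (first x v i) (first y v j) (j <ᵇ i)))
    (∑-before v y x))

cr-∷ : ∀ x v → cr (x ∷ v) ≡ over v x + cr v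
cr-∷ x v = trans (Crossing.countArcPairs-∷ x v) (cong (_+ cr v) (attached≡over v x))

ne-∷ : ∀ x v → ne (x ∷ v) ≡ left v x + ne v
ne-∷ x v = trans (Nesting.countArcPairs-∷ x v) (cong (_+ ne v) (attached≡left v x))

-- Counting blocks.

not-∨ : ∀ a b → not (a ∨ b) ≡ not a ∧ not b
not-∨ true  b = refl
not-∨ false b = refl

-- The predicate makes a recursion possible: once a letter is read, its label must be excluded from
-- the rest. With `0 ≤ᵇ_` as predicate this computes to `blocks`.
blocksIn : (ℕ → Bool) → List ℕ → ℕ
blocksIn p w = ∑ (length w) λ i → 𝟙 (p (at w i) ∧ not (seen (at w i) w i))

blocksIn-cong : ∀ {p q} → (∀ x → p x ≡ q x) → ∀ w → blocksIn p w ≡ blocksIn q w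
blocksIn-cong p≗q w = ∑-cong (length w) λ i → cong (λ b → 𝟙 (b ∧ not (seen (at w i) w i))) (p≗q (at w i))

blocksIn-∷ : ∀ p x v → blocksIn p (x ∷ v) ≡ 𝟙 (p x) + blocksIn (λ y → p y ∧ not (x ≡ᵇ y)) v
blocksIn-∷ p x v = trans (∑-suc (length v) _) (cong₂ _+_
  (cong 𝟙 (trans (cong (λ b → p x ∧ not b) (seen-0 x (x ∷ v))) (∧-identityʳ (p x))))
  (∑-cong (length v) λ i → cong 𝟙 (begin
    p (at v i) ∧ not (seen (at v i) (x ∷ v) (suc i))
      ≡⟨ cong (λ b → p (at v i) ∧ not b) (seen-suc (at v i) x v i) ⟩
    p (at v i) ∧ not ((x ≡ᵇ at v i) ∨ seen (at v i) v i)
      ≡⟨ cong (p (at v i) ∧_) (not-∨ (x ≡ᵇ at v i) _) ⟩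
    p (at v i) ∧ not (x ≡ᵇ at v i) ∧ not (seen (at v i) v i)
      ≡⟨ ∧-assoc (p (at v i)) _ _ ⟨
    (p (at v i) ∧ not (x ≡ᵇ at v i)) ∧ not (seen (at v i) v i) ∎)))
  where
  open ≡-Reasoning

-- Boolean tests, and invariance under injective relabelling.

T⇒≡ : ∀ {b} → T b → b ≡ true
T⇒≡ = Equivalence.to T-≡

≡⇒T : ∀ {b} → b ≡ true → T b
≡⇒T = Equivalence.from T-≡

¬T⇒≡ : ∀ {b} → ¬ T b → b ≡ false
¬T⇒≡ {false} _  = refl
¬T⇒≡ {true}  ¬t = contradiction tt ¬t

≡ᵇ-refl : ∀ n → (n ≡ᵇ n) ≡ true
≡ᵇ-refl n = T⇒≡ (≡⇒≡ᵇ n n refl)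

≢⇒≡ᵇ : ∀ {m n} → m ≢ n → (m ≡ᵇ n) ≡ false
≢⇒≡ᵇ m≢n = ¬T⇒≡ λ t → m≢n (≡ᵇ⇒≡ _ _ t)

<⇒<ᵇ-true : ∀ {m n} → m < n → (m <ᵇ n) ≡ true
<⇒<ᵇ-true m<n = T⇒≡ (<⇒<ᵇ m<n)

≮⇒<ᵇ-false : ∀ {m n} → n ≤ m → (m <ᵇ n) ≡ false
≮⇒<ᵇ-false {m} {n} n≤m = ¬T⇒≡ λ t → ≤⇒≯ n≤m (<ᵇ⇒< m n t)

≤ᵇ-true : ∀ {m n} → m ≤ n → (m ≤ᵇ n) ≡ true
≤ᵇ-true m≤n = T⇒≡ (≤⇒≤ᵇ m≤n)

≤ᵇ-false : ∀ {m n} → n < m → (m ≤ᵇ n) ≡ false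
≤ᵇ-false {m} {n} n<m = ¬T⇒≡ λ t → <⇒≱ n<m (≤ᵇ⇒≤ m n t)

module Relabel (f : ℕ → ℕ) (f-inj : Injective _≡_ _≡_ f) where

  ≡ᵇ-relabel : ∀ x y → (f x ≡ᵇ f y) ≡ (x ≡ᵇ y)
  ≡ᵇ-relabel x y with x ≟ y
  ... | yes refl = trans (≡ᵇ-refl (f x)) (sym (≡ᵇ-refl x))
  ... | no x≢y   = trans (≢⇒≡ᵇ (x≢y ∘ f-inj)) (sym (≢⇒≡ᵇ x≢y))

  occ-relabel : ∀ v x → occ (map f v) (f x) ≡ occ v x
  occ-relabel []      x = refl
  occ-relabel (z ∷ v) x rewrite ≡ᵇ-relabel z x | occ-relabel v x = refl

  before-relabel : ∀ v x y → before (map f v) (f x) (f y) ≡ before v x y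
  before-relabel []      x y = refl
  before-relabel (z ∷ v) x y
    rewrite ≡ᵇ-relabel z x | ≡ᵇ-relabel z y | occ-relabel v y | before-relabel v x y = refl

  over-relabel : ∀ v x → over (map f v) (f x) ≡ over v x
  over-relabel []      x = refl
  over-relabel (y ∷ v) x rewrite ≡ᵇ-relabel y x | before-relabel v x y | over-relabel v x = refl

  left-relabel : ∀ v x → left (map f v) (f x) ≡ left v x
  left-relabel []      x = refl
  left-relabel (y ∷ v) x rewrite ≡ᵇ-relabel y x | before-relabel v y x | left-relabel v x = refl

  cr-relabel : ∀ v → cr (map f v) ≡ cr v
  cr-relabel []      = refl
  cr-relabel (x ∷ v) = trans (cr-∷ (f x) (map f v))
    (trans (cong₂ _+_ (over-relabel v x) (cr-relabel v)) (sym (cr-∷ x v)))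

  ne-relabel : ∀ v → ne (map f v) ≡ ne v
  ne-relabel []      = refl
  ne-relabel (x ∷ v) = trans (ne-∷ (f x) (map f v))
    (trans (cong₂ _+_ (left-relabel v x) (ne-relabel v)) (sym (ne-∷ x v)))

-- Restricted growth

-- Growth b w k: after b labels have been opened, w continues a restricted growth string
-- and k labels have been opened at its end.
data Growth : ℕ → List ℕ → ℕ → Set where
  []  : ∀ {b} → Growth b [] b
  old : ∀ {b x w k} → x < b → Growth b w k → Growth b (x ∷ w) k
  new : ∀ {b w k} → Growth (suc b) w k → Growth b (b ∷ w) k

growth⇒rgs : ∀ {b w k} → Growth b w k → rgs b w ≡ true
growth⇒rgs [] = refl
growth⇒rgs {b} (old {x = x} x<b g)
  rewrite ≤ᵇ-true (<⇒≤ x<b) | ≢⇒≡ᵇ (<⇒≢ x<b) = growth⇒rgs g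
growth⇒rgs {b} (new g) rewrite ≤ᵇ-true (≤-refl {b}) | ≡ᵇ-refl b = growth⇒rgs g

rgs⇒growth : ∀ b w → rgs b w ≡ true → ∃ (Growth b w)
rgs⇒growth b []      eq = b , []
rgs⇒growth b (x ∷ w) eq with <-cmp x b
... | tri< x<b x≢b _ rewrite ≤ᵇ-true (<⇒≤ x<b) | ≢⇒≡ᵇ x≢b =
  let k , g = rgs⇒growth b w eq in k , old x<b g
... | tri≈ _ refl _ rewrite ≤ᵇ-true (≤-refl {b}) | ≡ᵇ-refl b =
  let k , g = rgs⇒growth (suc b) w eq in k , new g
... | tri> _ _ b<x rewrite ≤ᵇ-false b<x with () ← eq

growth-≤ : ∀ {b w k} → Growth b w k → b ≤ k
growth-≤ []        = ≤-refl
growth-≤ (old _ g) = growth-≤ g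
growth-≤ (new g)   = ≤-trans (n≤1+n _) (growth-≤ g)

-- With `b = 0` this places a growth string of length `n` among `words n n`, from which `Π n` is
-- filtered.
growth-labels : ∀ {b w k} → Growth b w k → All (_< b + length w) w
growth-labels []                 = []
growth-labels {b} (old {w = w} x<b g) = ≤-trans x<b (m≤m+n b _)
  ∷ All.map (λ lt → ≤-trans lt (+-monoʳ-≤ b (n≤1+n (length w)))) (growth-labels g)
growth-labels {b} (new {w = w} g) = ≤-trans (s≤s (m≤m+n b (length w))) (≤-reflexive (sym (+-suc b (length w))))
  ∷ All.map (λ lt → ≤-trans lt (≤-reflexive (sym (+-suc b (length w))))) (growth-labels g)

-- The labels from `b` on are those opened by `w` itself. An old letter lies below `b`, so excluding
-- it changes nothing; a new letter turns the bound `b` into `suc b`.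
growth-blocksIn : ∀ {b w k} → Growth b w k → b + blocksIn (b ≤ᵇ_) w ≡ k
growth-blocksIn {b} [] = +-identityʳ b
growth-blocksIn {b} (old {x = x} {w} x<b g) = trans (cong (b +_) (trans (blocksIn-∷ (b ≤ᵇ_) x w)
  (cong₂ _+_ (cong 𝟙 (≤ᵇ-false x<b)) (blocksIn-cong same w)))) (growth-blocksIn g)
  where
  same : ∀ y → (b ≤ᵇ y) ∧ not (x ≡ᵇ y) ≡ (b ≤ᵇ y)
  same y with b ≤? y
  ... | yes b≤y rewrite ≤ᵇ-true b≤y | ≢⇒≡ᵇ (<⇒≢ (<-≤-trans x<b b≤y)) = refl
  ... | no b≰y  rewrite ≤ᵇ-false (≰⇒> b≰y) = refl
growth-blocksIn {b} (new {w = w} g) = trans (cong (b +_) (trans (blocksIn-∷ (b ≤ᵇ_) b w)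
  (cong₂ _+_ (cong 𝟙 (≤ᵇ-true (≤-refl {b}))) (blocksIn-cong step w))))
  (trans (+-suc b _) (growth-blocksIn g))
  where
  step : ∀ y → (b ≤ᵇ y) ∧ not (b ≡ᵇ y) ≡ (suc b ≤ᵇ y)
  step y with <-cmp b y
  ... | tri< b<y b≢y _  rewrite ≤ᵇ-true (<⇒≤ b<y) | ≢⇒≡ᵇ b≢y = sym (<⇒<ᵇ-true b<y)
  ... | tri≈ _ refl _   rewrite ≤ᵇ-true (≤-refl {b}) | ≡ᵇ-refl b = sym (≮⇒<ᵇ-false (≤-refl {b}))
  ... | tri> _ _ y<b    rewrite ≤ᵇ-false y<b = sym (≮⇒<ᵇ-false (<⇒≤ y<b))

growth-blocks : ∀ {w k} → Growth 0 w k → blocks w ≡ k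
growth-blocks = growth-blocksIn

absent-∷ : ∀ z v x → occ (z ∷ v) x ≡ 0 → (z ≡ᵇ x) ≡ false × occ v x ≡ 0
absent-∷ z v x eq with z ≡ᵇ x
... | false = refl , eq

before-absentˡ : ∀ v x y → occ v x ≡ 0 → before v x y ≡ 0
before-absentˡ []      x y eq = refl
before-absentˡ (z ∷ v) x y eq with p , q ← absent-∷ z v x eq
  rewrite p | before-absentˡ v x y q with z ≡ᵇ y
... | true  = refl
... | false = refl

before-absentʳ : ∀ v x y → occ v y ≡ 0 → before v x y ≡ 0
before-absentʳ []      x y eq = refl
before-absentʳ (z ∷ v) x y eq with p , q ← absent-∷ z v y eq
  rewrite p | q | before-absentʳ v x y q with z ≡ᵇ x
... | true  = refl
... | false = refl

over-absent : ∀ v x → occ v x ≡ 0 → over v x ≡ 0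
over-absent []      x eq = refl
over-absent (y ∷ v) x eq with p , q ← absent-∷ y v x eq
  rewrite p | before-absentˡ v x y q = over-absent v x q

left-absent : ∀ v x → occ v x ≡ 0 → left v x ≡ 0
left-absent []      x eq = refl
left-absent (y ∷ v) x eq with p , q ← absent-∷ y v x eq
  rewrite p | before-absentʳ v y x q = left-absent v x q

growth-occ : ∀ {b w k x} → Growth b w k → b ≤ x → x < k → occ w x ≡ 1
growth-occ [] b≤x x<b = contradiction x<b (≤⇒≯ b≤x)
growth-occ (old z<b g) b≤x x<k rewrite ≢⇒≡ᵇ (<⇒≢ (<-≤-trans z<b b≤x)) = growth-occ g b≤x x<k
growth-occ {b} (new g) b≤x x<k with m≤n⇒m<n∨m≡n b≤x
... | inj₁ b<x rewrite ≢⇒≡ᵇ (<⇒≢ b<x) = growth-occ g b<x x<k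
... | inj₂ refl rewrite ≡ᵇ-refl b = refl

growth-absent : ∀ {b w k x} → Growth b w k → k ≤ x → occ w x ≡ 0
growth-absent [] k≤x = refl
growth-absent (old z<b g) k≤x
  rewrite ≢⇒≡ᵇ (<⇒≢ (<-≤-trans z<b (≤-trans (growth-≤ g) k≤x))) = growth-absent g k≤x
growth-absent (new g) k≤x rewrite ≢⇒≡ᵇ (<⇒≢ (≤-trans (growth-≤ g) k≤x)) = growth-absent g k≤x

-- Labels from `b` on are opened in increasing order.
growth-before : ∀ {b w k x y} → Growth b w k → b ≤ x → x < y → y < k → before w x y ≡ 1
growth-before [] b≤x x<y y<b = contradiction (<-trans x<y y<b) (≤⇒≯ b≤x)
growth-before (old z<b g) b≤x x<y y<k
  rewrite ≢⇒≡ᵇ (<⇒≢ (<-≤-trans z<b b≤x)) | ≢⇒≡ᵇ (<⇒≢ (<-trans (<-≤-trans z<b b≤x) x<y))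
  = growth-before g b≤x x<y y<k
growth-before {b} (new g) b≤x x<y y<k rewrite ≢⇒≡ᵇ (<⇒≢ (≤-<-trans b≤x x<y)) with m≤n⇒m<n∨m≡n b≤x
... | inj₁ b<x rewrite ≢⇒≡ᵇ (<⇒≢ b<x) = growth-before g b<x x<y y<k
... | inj₂ refl rewrite ≡ᵇ-refl b = growth-occ g x<y y<k

growth-¬before : ∀ {b w k x y} → Growth b w k → b ≤ x → x < y → before w y x ≡ 0
growth-¬before [] b≤x x<y = refl
growth-¬before (old z<b g) b≤x x<y
  rewrite ≢⇒≡ᵇ (<⇒≢ (<-≤-trans z<b b≤x)) | ≢⇒≡ᵇ (<⇒≢ (<-trans (<-≤-trans z<b b≤x) x<y))
  = growth-¬before g b≤x x<y
growth-¬before {b} (new g) b≤x x<y rewrite ≢⇒≡ᵇ (<⇒≢ (≤-<-trans b≤x x<y)) with m≤n⇒m<n∨m≡n b≤x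
... | inj₁ b<x rewrite ≢⇒≡ᵇ (<⇒≢ b<x) = growth-¬before g b<x x<y
... | inj₂ refl rewrite ≡ᵇ-refl b = refl

-- The relabelling caused by a new first element joining block i (or, when i is the
-- number of blocks, forming a new block): block i becomes block 0.
rotate : ℕ → ℕ → ℕ
rotate i x = if x <ᵇ i then suc x else (if x ≡ᵇ i then 0 else x)

rotate-< : ∀ {i x} → x < i → rotate i x ≡ suc x
rotate-< x<i rewrite <⇒<ᵇ-true x<i = refl

rotate-≡ : ∀ i → rotate i i ≡ 0
rotate-≡ i rewrite ≮⇒<ᵇ-false (≤-refl {i}) | ≡ᵇ-refl i = refl

rotate-> : ∀ {i x} → i < x → rotate i x ≡ x
rotate-> i<x rewrite ≮⇒<ᵇ-false (<⇒≤ i<x) | ≢⇒≡ᵇ (>⇒≢ i<x) = refl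

unrotate : ℕ → ℕ → ℕ
unrotate i zero    = i
unrotate i (suc y) = if y <ᵇ i then y else suc y

unrotate-rotate : ∀ i x → unrotate i (rotate i x) ≡ x
unrotate-rotate i x with <-cmp x i
... | tri< x<i _ _ rewrite rotate-< x<i | <⇒<ᵇ-true x<i = refl
... | tri≈ _ refl _ rewrite rotate-≡ i = refl
unrotate-rotate i (suc x) | tri> _ _ i<x rewrite rotate-> i<x | ≮⇒<ᵇ-false (≤-pred i<x) = refl

rotate-unrotate : ∀ i y → rotate i (unrotate i y) ≡ y
rotate-unrotate i zero    = rotate-≡ i
rotate-unrotate i (suc y) with y <? i
... | yes y<i rewrite <⇒<ᵇ-true y<i = rotate-< y<i
... | no y≮i rewrite ≮⇒<ᵇ-false (≮⇒≥ y≮i) = rotate-> (s≤s (≮⇒≥ y≮i))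

rotate-injective : ∀ i → Injective _≡_ _≡_ (rotate i)
rotate-injective i {x} {y} eq =
  trans (sym (unrotate-rotate i x)) (trans (cong (unrotate i) eq) (unrotate-rotate i y))

unrotate-bound : ∀ {i b y} → i < b → y < b → unrotate i y < b
unrotate-bound {y = zero}  i<b y<b = i<b
unrotate-bound {i} {y = suc y} i<b y<b with y <ᵇ i
... | true  = ≤-trans (n≤1+n _) y<b
... | false = y<b

rotate-bound : ∀ {i b x} → i < b → x < b → rotate i x < b
rotate-bound {i} {x = x} i<b x<b with <-cmp x i
... | tri< x<i _ _ rewrite rotate-< x<i = ≤-<-trans x<i i<b
... | tri≈ _ refl _ rewrite rotate-≡ i = ≤-<-trans z≤n i<b
... | tri> _ _ i<x rewrite rotate-> i<x = x<b

-- Once block `i` is open, the relabelling permutes the labels below `b` and fixes all others.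
growth-rotate : ∀ {i b w k} → i < b → Growth b w k → Growth b (map (rotate i) w) k
growth-rotate i<b []          = []
growth-rotate i<b (old x<b g) = old (rotate-bound i<b x<b) (growth-rotate i<b g)
growth-rotate i<b (new g) rewrite rotate-> i<b = new (growth-rotate (≤-trans i<b (n≤1+n _)) g)

growth-unrotate : ∀ {i b w k} → i < b → Growth b w k → Growth b (map (unrotate i) w) k
growth-unrotate i<b []          = []
growth-unrotate i<b (old x<b g) = old (unrotate-bound i<b x<b) (growth-unrotate i<b g)
growth-unrotate {i} {suc b} i<b (new g) rewrite ≮⇒<ᵇ-false (≤-pred i<b) =
  new (growth-unrotate (≤-trans i<b (n≤1+n _)) g)

-- The new first element already holds label 0, so labels are shifted by one until block `i` is
-- opened. That letter becomes an old 0, and `growth-rotate` takes over.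
growth-join : ∀ {i b w k} → b ≤ i → i < k → Growth b w k → Growth (suc b) (map (rotate i) w) k
growth-join b≤i i<b []          = contradiction i<b (≤⇒≯ b≤i)
growth-join b≤i i<k (old x<b g) rewrite rotate-< (<-≤-trans x<b b≤i) = old (s≤s x<b) (growth-join b≤i i<k g)
growth-join {i} b≤i i<k (new g) with m≤n⇒m<n∨m≡n b≤i
... | inj₁ b<i rewrite rotate-< b<i = new (growth-join b<i i<k g)
... | inj₂ refl rewrite rotate-≡ i  = old (s≤s z≤n) (growth-rotate (n<1+n i) g)

growth-fresh : ∀ {b w k} → Growth b w k → Growth (suc b) (map (rotate k) w) (suc k)
growth-fresh []          = []
growth-fresh (old x<b g) rewrite rotate-< (<-≤-trans x<b (growth-≤ g)) = old (s≤s x<b) (growth-fresh g)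
growth-fresh (new g) rewrite rotate-< (growth-≤ g) = new (growth-fresh g)

-- Children of a partition.

child : ℕ → List ℕ → List ℕ
child i w = 0 ∷ map (rotate i) w

child-join : ∀ {i w k} → i < k → Growth 0 w k → Growth 0 (child i w) k
child-join i<k g = new (growth-join z≤n i<k g)

child-fresh : ∀ {w k} → Growth 0 w k → Growth 0 (child k w) (suc k)
child-fresh g = new (growth-fresh g)

child-growth : ∀ {i w k} → i ≤ k → Growth 0 w k → ∃ (Growth 0 (child i w))
child-growth i≤k g with m≤n⇒m<n∨m≡n i≤k
... | inj₁ i<k  = _ , child-join i<k g
... | inj₂ refl = _ , child-fresh g

map-rotate-unrotate : ∀ i v → map (rotate i) (map (unrotate i) v) ≡ v
map-rotate-unrotate i []      = refl
map-rotate-unrotate i (y ∷ v) = cong₂ _∷_ (rotate-unrotate i y) (map-rotate-unrotate i v)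

record Parent (b : ℕ) (v : List ℕ) : Set where
  constructor parent
  field
    {index total} : ℕ
    {word}        : List ℕ
    lower         : b ≤ index
    upper         : index ≤ total
    growth        : Growth b word total
    rotated       : map (rotate index) word ≡ v

-- The first letter 0 in `v` marks where the joined block was opened, so its index is the number of
-- labels the parent has opened by then. If there is no 0, the first element was a singleton and the
-- index is the total.
growth-parent : ∀ {b v k} → Growth (suc b) v k → Parent b v
growth-parent []                            = parent ≤-refl ≤-refl [] refl
growth-parent {b} (old {x = zero} {w} x<b g) = parent ≤-refl
  (≤-trans (n≤1+n b) (growth-≤ g)) (new (growth-unrotate ≤-refl g))
  (cong₂ _∷_ (rotate-≡ b) (map-rotate-unrotate b w))
growth-parent (old {x = suc x} (s≤s x<b) g) =
  let parent lo up g′ eq = growth-parent g in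
  parent lo up (old x<b g′) (cong₂ _∷_ (rotate-< (<-≤-trans x<b lo)) eq)
growth-parent (new g) =
  let parent lo up g′ eq = growth-parent g in
  parent (<⇒≤ lo) up (new g′) (cong₂ _∷_ (rotate-< lo) eq)

-- Up to the first 0 of the common image both words are shifted by one and agree. That 0 appears
-- where block `i`, respectively `j`, is opened, so the indices agree; beyond it injectivity
-- suffices. If no 0 appears, both indices equal the final number of labels.
rotate-unique : ∀ {b i j w w′ k k′} → Growth b w k → Growth b w′ k′ →
  b ≤ i → i ≤ k → b ≤ j → j ≤ k′ → map (rotate i) w ≡ map (rotate j) w′ → i ≡ j × w ≡ w′
rotate-unique [] [] b≤i i≤b b≤j j≤b eq = trans (≤-antisym i≤b b≤i) (≤-antisym b≤j j≤b) , refl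
rotate-unique {b} (old x<b g) (old y<b h) b≤i i≤k b≤j j≤k eq
  with p , q ← ∷-injective eq
  rewrite rotate-< (<-≤-trans x<b b≤i) | rotate-< (<-≤-trans y<b b≤j)
  with i≡j , w≡w′ ← rotate-unique g h b≤i i≤k b≤j j≤k q
  = i≡j , cong₂ _∷_ (suc-injective p) w≡w′
rotate-unique {b} (old x<b g) (new h) b≤i i≤k b≤j j≤k eq
  with p , q ← ∷-injective eq
  rewrite rotate-< (<-≤-trans x<b b≤i) with m≤n⇒m<n∨m≡n b≤j
... | inj₁ b<j rewrite rotate-< b<j = contradiction (suc-injective p) (<⇒≢ x<b)
... | inj₂ refl = contradiction (trans p (rotate-≡ b)) λ ()
rotate-unique {b} (new g) (old y<b h) b≤i i≤k b≤j j≤k eq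
  with p , q ← ∷-injective eq
  rewrite rotate-< (<-≤-trans y<b b≤j) with m≤n⇒m<n∨m≡n b≤i
... | inj₁ b<i rewrite rotate-< b<i = contradiction (suc-injective p) (>⇒≢ y<b)
... | inj₂ refl = contradiction (trans (sym (rotate-≡ b)) p) λ ()
rotate-unique {b} (new g) (new h) b≤i i≤k b≤j j≤k eq
  with p , q ← ∷-injective eq | m≤n⇒m<n∨m≡n b≤i | m≤n⇒m<n∨m≡n b≤j
... | inj₁ b<i | inj₁ b<j =
  let i≡j , w≡w′ = rotate-unique g h b<i i≤k b<j j≤k q in i≡j , cong (_ ∷_) w≡w′
... | inj₂ refl | inj₂ refl = refl , cong (_ ∷_) (map-injective (rotate-injective b) q)
... | inj₁ b<i | inj₂ refl = contradiction (trans (sym (rotate-< b<i)) (trans p (rotate-≡ b))) λ ()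
... | inj₂ refl | inj₁ b<j = contradiction (trans (sym (rotate-< b<j)) (trans (sym p) (rotate-≡ b))) λ ()

child-unique : ∀ {i j w w′ k k′} → Growth 0 w k → Growth 0 w′ k′ → i ≤ k → j ≤ k′ →
  child i w ≡ child j w′ → i ≡ j × w ≡ w′
child-unique g h i≤k j≤k eq = rotate-unique g h z≤n i≤k z≤n j≤k (∷-injectiveʳ eq)

children : List ℕ → List (List ℕ)
children w = applyUpTo (λ i → child i w) (suc (blocks w))

∈-children⁻ : ∀ {w k v} → Growth 0 w k → v ∈ children w → ∃ λ i → i ≤ k × v ≡ child i w
∈-children⁻ {w} g v∈ with i , s≤s i≤ , eq ← ∈-applyUpTo⁻ (λ i → child i w) v∈ =
  i , subst (i ≤_) (growth-blocks g) i≤ , eq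

∈-children⁺ : ∀ {w k i} → Growth 0 w k → i ≤ k → child i w ∈ children w
∈-children⁺ {w} {i = i} g i≤k = ∈-applyUpTo⁺ (λ i → child i w) (s≤s (subst (i ≤_) (sym (growth-blocks g)) i≤k))

Partition : List ℕ → Set
Partition w = ∃ (Growth 0 w)

children-unique : ∀ {w} → Partition w → Unique (children w)
children-unique {w} (k , g) = Unique.applyUpTo⁺₁ (λ i → child i w) _ λ { {i} {j} i<j (s≤s j≤) eq →
  let j≤k = subst (j ≤_) (growth-blocks g) j≤ in
  <⇒≢ i<j (proj₁ (child-unique g g (≤-trans (<⇒≤ i<j) j≤k) j≤k eq)) }

concatMap-children-unique : ∀ {ws} → All Partition ws → Unique ws → Unique (concatMap children ws)
concatMap-children-unique []       []           = []
concatMap-children-unique {w ∷ ws} (p@(k , g) ∷ ps) (w∉ws ∷ u) =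
  Unique.++⁺ (children-unique p) (concatMap-children-unique ps u) disjoint
  where
  disjoint : ∀ {v} → v ∈ children w × v ∈ concatMap children ws → _
  disjoint (v∈w , v∈ws) with find (∈-concatMap⁻ children {xs = ws} v∈ws)
  ... | w′ , w′∈ws , v∈w′ with All.lookup ps w′∈ws
  ... | k′ , g′ with ∈-children⁻ g v∈w | ∈-children⁻ g′ v∈w′
  ... | i , i≤k , refl | j , j≤k′ , eq =
    All.lookup w∉ws w′∈ws (proj₂ (child-unique g g′ i≤k j≤k′ eq))

-- Enumeration of partitions

words-cartesianProduct : ∀ k m → words k (suc m) ≡ cartesianProductWith _∷_ (upTo k) (words k m)
words-cartesianProduct k m = go (upTo k)
  where
  go : ∀ xs → concatMap (λ x → map (x ∷_) (words k m)) xs ≡ cartesianProductWith _∷_ xs (words k m)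
  go []       = refl
  go (x ∷ xs) = cong (map (x ∷_) (words k m) ++_) (go xs)

words-unique : ∀ k m → Unique (words k m)
words-unique k zero    = [] ∷ []
words-unique k (suc m) = subst Unique (sym (words-cartesianProduct k m))
  (Unique.cartesianProductWith⁺ _∷_ ∷-injective (Unique.upTo⁺ k) (words-unique k m))

∈-words⁻ : ∀ k m {w} → w ∈ words k m → length w ≡ m
∈-words⁻ k zero    (here refl) = refl
∈-words⁻ k (suc m) w∈
  with x , v , _ , v∈ , refl ← ∈-cartesianProductWith⁻ _∷_ (upTo k) (words k m)
    (subst (_ ∈_) (words-cartesianProduct k m) w∈) = cong suc (∈-words⁻ k m v∈)

∈-words⁺ : ∀ k {w} → All (_< k) w → w ∈ words k (length w)
∈-words⁺ k []                 = here refl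
∈-words⁺ k {_ ∷ w} (x<k ∷ ps) = subst (_ ∈_) (sym (words-cartesianProduct k (length w)))
  (∈-cartesianProductWith⁺ _∷_ (∈-upTo⁺ x<k) (∈-words⁺ k ps))

Π-unique : ∀ n → Unique (Π n)
Π-unique n = Unique.filter⁺ (T? ∘ isRGS) (words-unique n n)

∈-Π⁻ : ∀ {n w} → w ∈ Π n → length w ≡ n × Partition w
∈-Π⁻ {n} {w} w∈ with p , q ← ∈-filter⁻ (T? ∘ isRGS) {xs = words n n} w∈ = ∈-words⁻ n n p , rgs⇒growth 0 w (T⇒≡ q)

∈-Π⁺ : ∀ {n w} → length w ≡ n → Partition w → w ∈ Π n
∈-Π⁺ refl (k , g) = ∈-filter⁺ (T? ∘ isRGS) (∈-words⁺ _ (growth-labels g)) (≡⇒T (growth⇒rgs g))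

-- Restriction to the last elements and the levels of the tree.

Restricts : List ℕ → ℕ → List ℕ → Set
Restricts lam l μ = ∀ i j → i < length lam → j < length lam →
  (at lam i ≡ᵇ at lam j) ≡ (at μ (l + i) ≡ᵇ at μ (l + j))

and-upTo⁻ : ∀ f n → T (and (map f (upTo n))) → ∀ {i} → i < n → T (f i)
and-upTo⁻ f (suc n) t i<n
  with p , q ← Equivalence.to T-∧ (subst (T ∘ and) (map-upTo-suc f n) t) = go i<n
  where
  go : ∀ {i} → i < suc n → T (f i)
  go {zero}  _         = p
  go {suc i} (s≤s i<n) = and-upTo⁻ (f ∘ suc) n q i<n

and-upTo⁺ : ∀ f n → (∀ {i} → i < n → T (f i)) → T (and (map f (upTo n)))
and-upTo⁺ f zero    h = tt
and-upTo⁺ f (suc n) h = subst (T ∘ and) (sym (map-upTo-suc f n))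
  (Equivalence.from T-∧ (h (s≤s z≤n) , and-upTo⁺ (f ∘ suc) n (h ∘ s≤s)))

==ᴮ⇒≡ : ∀ a b → T (a ==ᴮ b) → a ≡ b
==ᴮ⇒≡ true  true  _ = refl
==ᴮ⇒≡ false false _ = refl

≡⇒==ᴮ : ∀ {a b} → a ≡ b → T (a ==ᴮ b)
≡⇒==ᴮ {true}  refl = tt
≡⇒==ᴮ {false} refl = tt

restrictsTo⁻ : ∀ lam l μ → T (restrictsTo lam l μ) → Restricts lam l μ
restrictsTo⁻ lam l μ t i j i< j< = ==ᴮ⇒≡ _ _ (and-upTo⁻ _ (length lam) (and-upTo⁻ _ (length lam) t i<) j<)

restrictsTo⁺ : ∀ lam l μ → Restricts lam l μ → T (restrictsTo lam l μ)
restrictsTo⁺ lam l μ r = and-upTo⁺ _ (length lam) λ {i} i< → and-upTo⁺ _ (length lam) λ {j} j< → ≡⇒==ᴮ (r i j i< j<)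

at-map : ∀ f v {i} → i < length v → at (map f v) i ≡ f (at v i)
at-map f (x ∷ v) {zero}  _       = refl
at-map f (x ∷ v) {suc i} (s≤s p) = at-map f v p

restricts-child : ∀ (lam : List ℕ) l i v → length v ≡ length lam + l →
  ∀ j k → j < length lam → k < length lam →
  (at (child i v) (suc l + j) ≡ᵇ at (child i v) (suc l + k)) ≡ (at v (l + j) ≡ᵇ at v (l + k))
restricts-child lam l i v eq j k j< k< = trans
  (cong₂ _≡ᵇ_ (at-map (rotate i) v (inside j<)) (at-map (rotate i) v (inside k<)))
  (Relabel.≡ᵇ-relabel (rotate i) (rotate-injective i) _ _)
  where
  -- Outside the word `at` returns the default 0, which `rotate i` need not fix.
  inside : ∀ {j} → j < length lam → l + j < length v
  inside {j} j< = subst (l + j <_) (trans (+-comm l (length lam)) (sym eq)) (+-monoʳ-< l j<)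

-- The hypothesis on the labels below b carries the positions of the blocks opened before w and v.
pattern-unique : ∀ {b w v k k′} → Growth b w k → Growth b v k′ → length w ≡ length v →
  (∀ {i c} → i < length w → c < b → (at w i ≡ᵇ c) ≡ (at v i ≡ᵇ c)) →
  Restricts w 0 v → w ≡ v
pattern-unique [] [] len labels r = refl
pattern-unique (old {x = x} x<b g) (old {x = y} y<b h) len labels r = cong₂ _∷_
  (sym (≡ᵇ⇒≡ y x (≡⇒T (trans (sym (labels (s≤s z≤n) x<b)) (≡ᵇ-refl x)))))
  (pattern-unique g h (suc-injective len) (labels ∘ s≤s) (λ i j i< j< → r (suc i) (suc j) (s≤s i<) (s≤s j<)))
pattern-unique {b} (old {x = x} x<b g) (new h) len labels r = contradiction
  (≡ᵇ⇒≡ b x (≡⇒T (trans (sym (labels (s≤s z≤n) x<b)) (≡ᵇ-refl x)))) (>⇒≢ x<b)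
pattern-unique {b} (new g) (old {x = y} y<b h) len labels r = contradiction
  (≡ᵇ⇒≡ b y (≡⇒T (trans (labels (s≤s z≤n) y<b) (≡ᵇ-refl y)))) (>⇒≢ y<b)
pattern-unique {b} (new {w = w} g) (new {w = v} h) len labels r = cong (b ∷_)
  (pattern-unique g h (suc-injective len) labels′ (λ i j i< j< → r (suc i) (suc j) (s≤s i<) (s≤s j<)))
  where
  labels′ : ∀ {i c} → i < length w → c < suc b → (at w i ≡ᵇ c) ≡ (at v i ≡ᵇ c)
  labels′ i< (s≤s c≤b) with m≤n⇒m<n∨m≡n c≤b
  ... | inj₁ c<b  = labels (s≤s i<) c<b
  ... | inj₂ refl = r _ 0 (s≤s i<) (s≤s z≤n)

𝒯-unique : ∀ lam l → Unique (𝒯 lam l)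
𝒯-unique lam l = Unique.filter⁺ (T? ∘ restrictsTo lam l) (Π-unique (length lam + l))

∈-𝒯⁻ : ∀ lam l {μ} → μ ∈ 𝒯 lam l → length μ ≡ length lam + l × Partition μ × Restricts lam l μ
∈-𝒯⁻ lam l {μ} μ∈ with p , q ← ∈-filter⁻ (T? ∘ restrictsTo lam l) {xs = Π (length lam + l)} μ∈
  with len , part ← ∈-Π⁻ p = len , part , restrictsTo⁻ lam l μ q

∈-𝒯⁺ : ∀ lam l {μ} → length μ ≡ length lam + l → Partition μ → Restricts lam l μ → μ ∈ 𝒯 lam l
∈-𝒯⁺ lam l {μ} len part r = ∈-filter⁺ (T? ∘ restrictsTo lam l) (∈-Π⁺ len part) (restrictsTo⁺ lam l μ r)

unique∧⊆⇒↭ : ∀ {a} {A : Set a} {xs ys : List A} → Unique xs → Unique ys →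
  (∀ {x} → x ∈ xs → x ∈ ys) → (∀ {x} → x ∈ ys → x ∈ xs) → xs ↭ₚ ys
unique∧⊆⇒↭ u v xs⊆ys ys⊆xs = ∼bag⇒↭ (unique∧set⇒bag u v (mk⇔ xs⊆ys ys⊆xs))

𝒯-zero : ∀ {lam} → Partition lam → 𝒯 lam 0 ↭ₚ [ lam ]
𝒯-zero {lam} part@(_ , g) = unique∧⊆⇒↭ (𝒯-unique lam 0) ([] ∷ []) to
  λ { (here refl) → ∈-𝒯⁺ lam 0 (sym (+-identityʳ _)) part (λ _ _ _ _ → refl) }
  where
  to : ∀ {μ} → μ ∈ 𝒯 lam 0 → μ ∈ [ lam ]
  to μ∈ with len , (_ , h) , r ← ∈-𝒯⁻ lam 0 μ∈ =
    here (sym (pattern-unique g h (sym (trans len (+-identityʳ _))) (λ _ ()) r))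

-- Removing the first element yields the parent. The restriction to the last elements does not see
-- the first one, so the condition transfers in both directions.
𝒯-suc : ∀ lam l → 𝒯 lam (suc l) ↭ₚ concatMap children (𝒯 lam l)
𝒯-suc lam l = unique∧⊆⇒↭ (𝒯-unique lam (suc l))
  (concatMap-children-unique (All.tabulate λ v∈ → proj₁ (proj₂ (∈-𝒯⁻ lam l v∈))) (𝒯-unique lam l)) to from
  where
  to : ∀ {μ} → μ ∈ 𝒯 lam (suc l) → μ ∈ concatMap children (𝒯 lam l)
  to μ∈ with ∈-𝒯⁻ lam (suc l) μ∈
  ... | len , (_ , []) , r = contradiction (trans len (+-suc (length lam) l)) λ ()
  ... | len , (_ , new g) , r with parent {i} {k} {v} _ i≤k h refl ← growth-parent g =
    ∈-concatMap⁺ children (lose (∈-𝒯⁺ lam l len′ (k , h)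
      (λ p q p< q< → trans (r p q p< q<) (restricts-child lam l i v len′ p q p< q<))) (∈-children⁺ h i≤k))
    where
    len′ : length v ≡ length lam + l
    len′ = trans (sym (length-map (rotate i) v)) (suc-injective (trans len (+-suc (length lam) l)))
  from : ∀ {μ} → μ ∈ concatMap children (𝒯 lam l) → μ ∈ 𝒯 lam (suc l)
  from μ∈ with v , v∈ , μ∈v ← find (∈-concatMap⁻ children {xs = 𝒯 lam l} μ∈)
    with len , (_ , g) , r ← ∈-𝒯⁻ lam l v∈
    with i , i≤k , refl ← ∈-children⁻ g μ∈v =
    ∈-𝒯⁺ lam (suc l) (trans (cong suc (trans (length-map (rotate i) v) len)) (sym (+-suc (length lam) l)))
      (child-growth i≤k g) (λ p q p< q< → trans (r p q p< q<) (sym (restricts-child lam l i v len p q p< q<)))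

tree : ℕ → List ℕ → List (List ℕ)
tree zero    w = [ w ]
tree (suc l) w = concatMap (tree l) (children w)

concatMap-concatMap : ∀ {a} {A B C : Set a} (g : B → List C) (f : A → List B) xs →
  concatMap (concatMap g ∘ f) xs ≡ concatMap g (concatMap f xs)
concatMap-concatMap g f []       = refl
concatMap-concatMap g f (x ∷ xs) = trans (cong (concatMap g (f x) ++_) (concatMap-concatMap g f xs))
  (sym (concatMap-++ g (f x) (concatMap f xs)))

-- `tree` branches at the root, as the recursion for `level` does, whereas `𝒯-suc` adds children at
-- the deepest level.
tree-suc : ∀ l w → tree (suc l) w ≡ concatMap children (tree l w)
tree-suc zero    w = trans (concatMap-pure (children w)) (sym (++-identityʳ (children w)))
tree-suc (suc l) w = trans (concatMap-cong (tree-suc l) (children w))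
  (concatMap-concatMap children (tree l) (children w))

concatMap-↭ : ∀ {a} {A B : Set a} (f : A → List B) {xs ys} → xs ↭ₚ ys → concatMap f xs ↭ₚ concatMap f ys
concatMap-↭ f Perm.refl         = ↭ₚ-refl
concatMap-↭ f (Perm.prep x p)     = Permₚ.++⁺ˡ (f x) (concatMap-↭ f p)
concatMap-↭ f (Perm.swap x y p)   = ↭ₚ-trans (Permₚ.shifts (f x) (f y)) (Permₚ.++⁺ˡ (f y) (Permₚ.++⁺ˡ (f x) (concatMap-↭ f p)))
concatMap-↭ f (Perm.trans p q)  = ↭ₚ-trans (concatMap-↭ f p) (concatMap-↭ f q)

𝒯↭tree : ∀ {lam} → Partition lam → ∀ l → 𝒯 lam l ↭ₚ tree l lam
𝒯↭tree part zero    = 𝒯-zero part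
𝒯↭tree {lam} part (suc l) = ↭ₚ-trans (𝒯-suc lam l)
  (↭ₚ-trans (concatMap-↭ children (𝒯↭tree part l)) (↭ₚ-reflexive (sym (tree-suc l lam))))

-- Values in the group

module Values {c ℓ} (G : AbelianGroup c ℓ) (α β : AbelianGroup.Carrier G) where

  open AbelianGroup G renaming (refl to ≈-refl; sym to ≈-sym; trans to ≈-trans)
  open Recursion G
  open Pick α β
  open SymmetricAffine
  open CommutativeSemigroupProperties commutativeSemigroup using () renaming (interchange to ∙-interchange)
  import Relation.Binary.Reasoning.Setoid setoid as ≈-Reasoning

  mult-+ : ∀ m n x → mult G (m + n) x ≈ mult G m x ∙ mult G n x
  mult-+ zero    n x = ≈-sym (identityˡ _)
  mult-+ (suc m) n x = ≈-trans (∙-congˡ (mult-+ m n x)) (≈-sym (assoc _ _ _))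

  value : ℕ → ℕ → Carrier
  value m n = mult G m α ∙ mult G n β

  value-+ : ∀ m n p q → value (m + p) (n + q) ≈ value m n ∙ value p q
  value-+ m n p q = ≈-trans (∙-cong (mult-+ m p α) (mult-+ n q β)) (∙-interchange _ _ _ _)

  value-0-0 : value 0 0 ≈ ε
  value-0-0 = identityˡ ε

  value-1-0 : value 1 0 ≈ α
  value-1-0 = ≈-trans (identityʳ _) (identityʳ α)

  value-0-1 : value 0 1 ≈ β
  value-0-1 = ≈-trans (identityˡ _) (identityʳ β)

  entry : List ℕ → ℕ → Carrier
  entry w t = value (over w t) (left w t)

  -- This lets a singleton be treated as joining the absent block `k`.
  entry-absent : ∀ {w k} → Growth 0 w k → entry w k ≈ ε
  entry-absent {w} {k} g = ≈-trans
    (reflexive (cong₂ value (over-absent w k absent) (left-absent w k absent))) value-0-0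
    where absent = growth-absent g ≤-refl

  -- The new letter 0 is `rotate i i`, so what it adds is read off from `w` at label `i`.
  s-child : ∀ i w → s G α β (child i w) ≈ s G α β w ∙ entry w i
  s-child i w = begin
    value (cr (0 ∷ v)) (ne (0 ∷ v))
      ≡⟨ cong₂ value (cr-∷ 0 v) (ne-∷ 0 v) ⟩
    value (over v 0 + cr v) (left v 0 + ne v)
      ≡⟨ cong (λ x → value (over v x + cr v) (left v x + ne v)) (rotate-≡ i) ⟨
    value (over v (rotate i i) + cr v) (left v (rotate i i) + ne v)
      ≡⟨ cong₂ value (cong₂ _+_ (over-relabel w i) (cr-relabel w)) (cong₂ _+_ (left-relabel w i) (ne-relabel w)) ⟩
    value (over w i + cr w) (left w i + ne w)
      ≈⟨ value-+ (over w i) (left w i) (cr w) (ne w) ⟩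
    entry w i ∙ s G α β w
      ≈⟨ comm _ _ ⟩
    s G α β w ∙ entry w i ∎
    where
    open ≈-Reasoning
    open Relabel (rotate i) (rotate-injective i)
    v = map (rotate i) w

  -- The new arc ends at the first element of block `i`. It passes over the first `x` if `x` opens
  -- before `i`, and ends before it if `i` opens first.
  entry-child : ∀ i w t x → suc t ≡ rotate i x →
    entry (child i w) (suc t) ≈ value (before w x i) (before w i x) ∙ entry w x
  entry-child i w t x eq = begin
    value (before v (suc t) 0 + over v (suc t)) (before v 0 (suc t) + left v (suc t))
      ≡⟨ cong₂ (λ y z → value (before v y z + over v y) (before v z y + left v y)) eq (sym (rotate-≡ i)) ⟩
    value (before v (rotate i x) (rotate i i) + over v (rotate i x))
          (before v (rotate i i) (rotate i x) + left v (rotate i x))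
      ≡⟨ cong₂ value (cong₂ _+_ (before-relabel w x i) (over-relabel w x))
                     (cong₂ _+_ (before-relabel w i x) (left-relabel w x)) ⟩
    value (before w x i + over w x) (before w i x + left w x)
      ≈⟨ value-+ (before w x i) (before w i x) (over w x) (left w x) ⟩
    value (before w x i) (before w i x) ∙ entry w x ∎
    where
    open ≈-Reasoning
    open Relabel (rotate i) (rotate-injective i)
    v = map (rotate i) w

  without-< : ∀ X {i t} → t < i → without X i t ≡ α ∙ X t
  without-< X {suc i} {zero}  _         = refl
  without-< X {suc i} {suc t} (s≤s t<i) = without-< (X ∘ suc) t<i

  without-≥ : ∀ X {i t} → i ≤ t → without X i t ≡ β ∙ X (suc t)
  without-≥ X {zero}  {t}     _         = refl
  without-≥ X {suc i} {suc t} (s≤s i≤t) = without-≥ (X ∘ suc) i≤t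

  -- Since block `i` moves to label 0, the child's label `suc t` was `t` if `t < i`, a block opened
  -- earlier, and otherwise was `suc t`, a block opened later.
  entry-join : ∀ {w k i t} → Growth 0 w k → i < k → suc t < k →
    entry (child i w) (suc t) ≈ without (entry w) i t
  entry-join {w} {k} {i} {t} g i<k t<k with t <? i
  ... | yes t<i = begin
    entry (child i w) (suc t)                       ≈⟨ entry-child i w t t (sym (rotate-< t<i)) ⟩
    value (before w t i) (before w i t) ∙ entry w t
      ≡⟨ cong₂ (λ p q → value p q ∙ entry w t) (growth-before g z≤n t<i i<k) (growth-¬before g z≤n t<i) ⟩
    value 1 0 ∙ entry w t                           ≈⟨ ∙-congʳ value-1-0 ⟩
    α ∙ entry w t                                   ≡⟨ without-< (entry w) t<i ⟨
    without (entry w) i t                           ∎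
    where open ≈-Reasoning
  ... | no t≮i = begin
    entry (child i w) (suc t)                       ≈⟨ entry-child i w t (suc t) (sym (rotate-> i<1+t)) ⟩
    value (before w (suc t) i) (before w i (suc t)) ∙ entry w (suc t)
      ≡⟨ cong₂ (λ p q → value p q ∙ entry w (suc t)) (growth-¬before g z≤n i<1+t) (growth-before g z≤n i<1+t t<k) ⟩
    value 0 1 ∙ entry w (suc t)                     ≈⟨ ∙-congʳ value-0-1 ⟩
    β ∙ entry w (suc t)                             ≡⟨ without-≥ (entry w) (≮⇒≥ t≮i) ⟨
    without (entry w) i t                           ∎
    where
    open ≈-Reasoning
    i<1+t : i < suc t
    i<1+t = s≤s (≮⇒≥ t≮i)

  entry-fresh : ∀ {w k t} → Growth 0 w k → t < k → entry (child k w) (suc t) ≈ entry w t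
  entry-fresh {w} {k} {t} g t<k = begin
    entry (child k w) (suc t)                       ≈⟨ entry-child k w t t (sym (rotate-< t<k)) ⟩
    value (before w t k) (before w k t) ∙ entry w t
      ≡⟨ cong₂ (λ p q → value p q ∙ entry w t) (before-absentʳ w t k absent) (before-absentˡ w k t absent) ⟩
    value 0 0 ∙ entry w t                           ≈⟨ ∙-congʳ value-0-0 ⟩
    ε ∙ entry w t                                   ≈⟨ identityˡ _ ⟩
    entry w t                                       ∎
    where
    open ≈-Reasoning
    absent = growth-absent g ≤-refl

  applyUpTo-cong : ∀ {f g} k → (∀ {t} → t < k → f t ≈ g t) → applyUpTo f k ↭ applyUpTo g k
  applyUpTo-cong zero    f≈g = ↭-refl
  applyUpTo-cong (suc k) f≈g = prep (f≈g (s≤s z≤n)) (applyUpTo-cong k (f≈g ∘ s≤s))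

  entries-join : ∀ {w k i} → Growth 0 w k → i < k →
    applyUpTo (entry (child i w)) k ↭ ε ∷ applyUpTo (without (entry w) i) (pred k)
  entries-join {k = suc k} g i<k = prep value-0-0 (applyUpTo-cong k (λ t<k → entry-join g i<k (s≤s t<k)))

  entries-fresh : ∀ {w k} → Growth 0 w k → applyUpTo (entry (child k w)) (suc k) ↭ ε ∷ applyUpTo (entry w) k
  entries-fresh {k = k} g = prep value-0-0 (applyUpTo-cong k (entry-fresh g))

  concat-applyUpTo-cong : ∀ {f g} k → (∀ {i} → i < k → f i ↭ g i) →
    concat (applyUpTo f k) ↭ concat (applyUpTo g k)
  concat-applyUpTo-cong zero    f↭g = ↭-refl
  concat-applyUpTo-cong (suc k) f↭g = ++⁺ (f↭g (s≤s z≤n)) (concat-applyUpTo-cong k (f↭g ∘ s≤s))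

  ·-concat-applyUpTo : ∀ x f k → concat (applyUpTo (λ i → x · f i) k) ↭ x · concat (applyUpTo f k)
  ·-concat-applyUpTo x f zero    = ↭-refl
  ·-concat-applyUpTo x f (suc k) = ↭-trans (++⁺ˡ (x · f 0) (·-concat-applyUpTo x (f ∘ suc) k))
    (↭-sym (·-++ x (f 0) _))

  values : ℕ → List (List ℕ) → List Carrier
  values m T = sMulti G α β (filterᵇ (λ μ → blocks μ ≡ᵇ m) T)

  values-++ : ∀ m T U → values m (T ++ U) ≡ values m T ++ values m U
  values-++ m T U = trans (cong (map (s G α β)) (filter-++ (λ μ → T? (blocks μ ≡ᵇ m)) T U))
    (map-++ (s G α β) (filterᵇ (λ μ → blocks μ ≡ᵇ m) T) _)

  values-concat : ∀ m Ts → values m (concat Ts) ≡ concat (map (values m) Ts)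
  values-concat m []       = refl
  values-concat m (T ∷ Ts) = trans (values-++ m T (concat Ts)) (cong (values m T ++_) (values-concat m Ts))

  values-tree-suc : ∀ {w k} → Growth 0 w k → ∀ l m → values m (tree (suc l) w)
    ≡ concat (applyUpTo (λ i → values m (tree l (child i w))) k) ++ values m (tree l (child k w))
  values-tree-suc {w} {k} g l m = begin
    values m (concat (map (tree l) (children w)))
      ≡⟨ values-concat m (map (tree l) (children w)) ⟩
    concat (map (values m) (map (tree l) (children w)))
      ≡⟨ cong (λ n → concat (map (values m) (map (tree l) (applyUpTo (λ i → child i w) (suc n))))) (growth-blocks g) ⟩
    concat (map (values m) (map (tree l) (applyUpTo (λ i → child i w) (suc k))))
      ≡⟨ cong (concat ∘ map (values m)) (map-applyUpTo (λ i → child i w) (tree l) (suc k)) ⟩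
    concat (map (values m) (applyUpTo (λ i → tree l (child i w)) (suc k)))
      ≡⟨ cong concat (map-applyUpTo (λ i → tree l (child i w)) (values m) (suc k)) ⟩
    concat (applyUpTo f (suc k))
      -- The last child is the one with a new singleton block.
      ≡⟨ cong concat (applyUpTo-∷ʳ f k) ⟨
    concat (applyUpTo f k ++ [ f k ])
      ≡⟨ concat-++ (applyUpTo f k) [ f k ] ⟨
    concat (applyUpTo f k) ++ concat [ f k ]
      ≡⟨ cong (concat (applyUpTo f k) ++_) (++-identityʳ (f k)) ⟩
    concat (applyUpTo f k) ++ f k ∎
    where
    open ≡-Reasoning
    f : ℕ → List Carrier
    f i = values m (tree l (child i w))

  -- Induction on `l` for all nodes at once. The entries of a child match the argument in the
  -- recursion only up to the equality of the group, which `level` respects.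
  values-tree : ∀ {w k} → Growth 0 w k → ∀ l m →
    values m (tree l w) ↭ s G α β w · level l m (applyUpTo (entry w) k)
  values-tree {w} {k} g zero m
    rewrite length-applyUpTo (entry w) k | sym (growth-blocks g) with blocks w ≡ᵇ m
  ... | true  = prep (≈-sym (identityʳ _)) ↭-refl
  ... | false = ↭-refl
  values-tree {w} {k} g (suc l) m = begin
    values m (tree (suc l) w)
      ≡⟨ values-tree-suc g l m ⟩
    concat (applyUpTo (λ i → values m (tree l (child i w))) k) ++ values m (tree l (child k w))
      ↭⟨ ++⁺ (↭-trans (concat-applyUpTo-cong k join) (·-concat-applyUpTo S _ k)) fresh ⟩
    S · concat (applyUpTo (λ i → entry w i · level l m (ε ∷ applyUpTo (without (entry w) i) (pred k))) k)
      ++ S · level l m (ε ∷ E)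
      ≡⟨ cong (λ xs → S · xs ++ S · level l m (ε ∷ E)) (pick-applyUpTo (level l m ∘ (ε ∷_)) (entry w) k) ⟨
    S · pick (level l m ∘ (ε ∷_)) E ++ S · level l m (ε ∷ E)
      ↭⟨ ++-comm (S · pick (level l m ∘ (ε ∷_)) E) _ ⟩
    S · level l m (ε ∷ E) ++ S · pick (level l m ∘ (ε ∷_)) E
      ↭⟨ ·-++ S (level l m (ε ∷ E)) _ ⟨
    S · level (suc l) m E ∎
    where
    open PermutationReasoning
    S = s G α β w
    E = applyUpTo (entry w) k
    symmetric = resp (level-symmetricAffine l m)
    join : ∀ {i} → i < k → values m (tree l (child i w))
      ↭ S · entry w i · level l m (ε ∷ applyUpTo (without (entry w) i) (pred k))
    join {i} i<k = ↭-trans (values-tree (child-join i<k g) l m)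
      (↭-trans (·-cong (s-child i w) (symmetric (entries-join g i<k))) (↭-sym (·-assoc S (entry w i) _)))
    fresh : values m (tree l (child k w)) ↭ S · level l m (ε ∷ E)
    fresh = ↭-trans (values-tree (child-fresh g) l m)
      (·-cong (≈-trans (s-child k w) (≈-trans (∙-congˡ (entry-absent g)) (identityʳ S)))
        (symmetric (entries-fresh g)))

  sMulti-↭ : ∀ {T U} → T ↭ₚ U → sMulti G α β T ↭ sMulti G α β U
  sMulti-↭ p = SetoidPermutationProperties.map⁺ (≡.setoid (List ℕ)) setoid
    (reflexive ∘ cong (s G α β)) (Perm.↭⇒↭ₛ p)

  sMulti-𝒯ᵐ : ∀ {w k} → Growth 0 w k → ∀ l m →
    sMulti G α β (𝒯ᵐ w l m) ↭ s G α β w · level l m (applyUpTo (entry w) k)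
  sMulti-𝒯ᵐ g l m = ↭-trans
    (sMulti-↭ (Permₚ.filter-↭ (λ μ → T? (blocks μ ≡ᵇ m)) (𝒯↭tree (_ , g) l)))
    (values-tree g l m)

  sMulti-𝒯-0 : ∀ {w k} → Growth 0 w k → sMulti G α β (𝒯 w 0) ↭ [ s G α β w ]
  sMulti-𝒯-0 g = sMulti-↭ (𝒯↭tree (_ , g) 0)

  -- The singleton child supplies `ε`, placed in front so that it cancels when two nodes are
  -- compared.
  sMulti-𝒯-1 : ∀ {w k} → Growth 0 w k → sMulti G α β (𝒯 w 1) ↭ s G α β w · (ε ∷ applyUpTo (entry w) k)
  sMulti-𝒯-1 {w} {k} g = begin
    sMulti G α β (𝒯 w 1)                           ↭⟨ sMulti-↭ (𝒯↭tree (_ , g) 1) ⟩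
    sMulti G α β (concatMap [_] (children w))      ≡⟨ cong (sMulti G α β) (concatMap-pure (children w)) ⟩
    sMulti G α β (children w)                      ≡⟨ map-applyUpTo (λ i → child i w) (s G α β) _ ⟩
    applyUpTo (λ i → s G α β (child i w)) (suc (blocks w))
      ≡⟨ cong (λ n → applyUpTo (λ i → s G α β (child i w)) (suc n)) (growth-blocks g) ⟩
    applyUpTo (λ i → s G α β (child i w)) (suc k)  ↭⟨ applyUpTo-cong (suc k) (λ {i} _ → s-child i w) ⟩
    applyUpTo (λ i → S ∙ entry w i) (suc k)        ≡⟨ map-applyUpTo (entry w) (S ∙_) (suc k) ⟨
    S · applyUpTo (entry w) (suc k)                ≡⟨ cong (S ·_) (applyUpTo-∷ʳ (entry w) k) ⟨
    S · (applyUpTo (entry w) k ∷ʳ entry w k)       ↭⟨ ·-congˡ (∷↭∷ʳ (entry w k) _) ⟨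
    S · (entry w k ∷ applyUpTo (entry w) k)        ↭⟨ ·-congˡ (prep (entry-absent g) ↭-refl) ⟩
    S · (ε ∷ applyUpTo (entry w) k)                ∎
    where
    open PermutationReasoning
    S = s G α β w

-- Levels 0 and 1 determine all levels.

module _ {c ℓ} (G : AbelianGroup c ℓ) where

  open AbelianGroup G renaming (refl to ≈-refl; sym to ≈-sym; trans to ≈-trans)
  open Recursion G
  open Pick using (level; level-symmetricAffine)
  open SetoidPermutationProperties setoid using (All-resp-↭)
  open SymmetricAffine

  ↭-[-]⇒≈ : ∀ {x y} → [ x ] ↭ [ y ] → x ≈ y
  ↭-[-]⇒≈ {x} p with y≈x ∷ [] ← All-resp-↭ (λ y≈z y≈x → ≈-trans (≈-sym y≈z) y≈x) p (≈-refl ∷ []) = ≈-sym y≈x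

  ·-cancel : ∀ g {xs ys} → g · xs ↭ g · ys → xs ↭ ys
  ·-cancel g {xs} {ys} p = ↭-trans (↭-sym (undo xs)) (↭-trans (·-congˡ p) (undo ys))
    where
    undo : ∀ zs → (g ⁻¹) · g · zs ↭ zs
    undo zs = ↭-trans (·-assoc (g ⁻¹) g zs) (↭-trans (·-cong (inverseˡ g) ↭-refl) (·-identity zs))

  -- Covers both parts: `flip` is reflexivity for (a) and `level-flip` for (b).
  𝒯ᵐ-determined : ∀ {α β α′ β′ λ′ π k k′} → (∀ l m xs → level α β l m xs ↭ level α′ β′ l m xs) →
    Growth 0 λ′ k → Growth 0 π k′ →
    (∀ l → l ≤ 1 → sMulti G α β (𝒯 λ′ l) ↭ sMulti G α′ β′ (𝒯 π l)) →
    ∀ l m → sMulti G α β (𝒯ᵐ λ′ l m) ↭ sMulti G α′ β′ (𝒯ᵐ π l m)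
  𝒯ᵐ-determined {α} {β} {α′} {β′} {λ′} {π} {k} {k′} flip g h agree l m = begin
    sMulti G α β (𝒯ᵐ λ′ l m)                                  ↭⟨ V.sMulti-𝒯ᵐ g l m ⟩
    s G α β λ′ · level α β l m (applyUpTo (V.entry λ′) k)
      ↭⟨ ·-cong same-value (↭-trans (resp (level-symmetricAffine α β l m) same-entries) (flip l m _)) ⟩
    s G α′ β′ π · level α′ β′ l m (applyUpTo (V′.entry π) k′) ↭⟨ V′.sMulti-𝒯ᵐ h l m ⟨
    sMulti G α′ β′ (𝒯ᵐ π l m)                                 ∎
    where
    open PermutationReasoning
    module V  = Values G α β
    module V′ = Values G α′ β′
    same-value : s G α β λ′ ≈ s G α′ β′ π
    same-value = ↭-[-]⇒≈ (↭-trans (↭-sym (V.sMulti-𝒯-0 g)) (↭-trans (agree 0 z≤n) (V′.sMulti-𝒯-0 h)))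
    same-entries : applyUpTo (V.entry λ′) k ↭ applyUpTo (V′.entry π) k′
    -- Level 0 makes the two translations equal, so they can be cancelled in level 1, and then the
    -- common `ε`.
    same-entries = drop-∷ (·-cancel (s G α β λ′) (↭-trans (↭-sym (V.sMulti-𝒯-1 g))
      (↭-trans (agree 1 ≤-refl) (↭-trans (V′.sMulti-𝒯-1 h) (·-cong (≈-sym same-value) ↭-refl)))))

theorem1p1 : ∀ {c ℓ} (G : AbelianGroup c ℓ) (α β : AbelianGroup.Carrier G)
    (lam pi : List ℕ) → isRGS lam ≡ true → isRGS pi ≡ true → lam ≢ [] → pi ≢ [] →
    ((∀ l → l ≤ 1 → _≡ₘ_ G (sMulti G α β (𝒯 lam l)) (sMulti G α β (𝒯 pi l)))
    → ∀ l m → _≡ₘ_ G (sMulti G α β (𝒯ᵐ lam l m)) (sMulti G α β (𝒯ᵐ pi l m)))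
    ×
    ((∀ l → l ≤ 1 → _≡ₘ_ G (sMulti G α β (𝒯 lam l)) (sMulti G β α (𝒯 pi l)))
    → ∀ l m → _≡ₘ_ G (sMulti G α β (𝒯ᵐ lam l m)) (sMulti G β α (𝒯ᵐ pi l m)))
theorem1p1 G α β lam pi rgs-lam rgs-pi _ _ =
    𝒯ᵐ-determined G (λ _ _ _ → ↭-refl) g h
  , 𝒯ᵐ-determined G (level-flip α β) g h
  where
  open Recursion G
  g = proj₂ (rgs⇒growth 0 lam rgs-lam)
  h = proj₂ (rgs⇒growth 0 pi rgs-pi)
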